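{- For every bipartite graph $G$, $F_G(z)=F_{G^*}(z)$, where $F_G(z)=\sum_{\boldsymbol a\in D(G)}z^{s(\boldsymbol a)}$ is the support-enumerator of $G$, and $G^*$ is the bipartite graph obtained from $G$ by swapping its left and right vertex sets.
   Context: A bipartite graph $G$ comes with an ordered bipartition into left vertices $\ell_1,\dots,\ell_m$ and right vertices $r_1,\dots,r_n$. For $j\in[m]=\{1,\dots,m\}$, $I_j=\{i\in[n]\mid\ell_j\text{ is adjacent to }r_i\}$. A $G$-draconian sequence is a sequence $(a_1,\dots,a_m)$ of nonnegative integers such that $\sum_{i\in J}a_i\le|\bigcup_{i\in J}I_i|$ for every nonempty $J\subset[m]$; $D(G)$ is the set of all of them. (Thus $D(G)\subset\mathbb Z_{\ge0}^m$ and $D(G^*)\subset\mathbb Z_{\ge0}^n$.) $s(\boldsymbol a)$ denotes the number of positive coordinates of $\boldsymbol a$. -}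

module Defs where

open import Data.Bool.Base using (Bool)
open import Data.Fin.Base using (Fin)
open import Data.Fin.Subset using (Subset; _∈_; Nonempty; ∣_∣; ⋃; ⁅_⁆)
open import Data.Fin.Subset.Properties
  using (_∈?_; nonempty?; anySubset?; ∣p∣≤n; x∈⁅x⁆)
open import Data.List.Base
  using (List; []; _∷_; map; foldr; filter; allFin; upTo; replicate; cartesianProductWith)
import Data.List.Membership.Propositional as List
open import Data.List.Membership.Propositional.Properties
  using (∈-map⁺; ∈-filter⁺; ∈-filter⁻; ∈-allFin; ∈-upTo⁺; ∈-cartesianProductWith⁺)
open import Data.List.Relation.Unary.Any using (here; there)
open import Data.List.Relation.Unary.Unique.Propositional using (Unique)
import Data.List.Relation.Unary.Unique.Propositional.Properties as Unique
open import Data.List.Relation.Unary.AllPairs using ([]; _∷_)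
open import Data.List.Relation.Unary.All using ([])
open import Data.Nat.Base using (ℕ; zero; suc; _+_; _≤_; s≤s)
open import Data.Nat.ListAction using (sum)
open import Data.Nat.Properties using (_≤?_; _<?_; ≤-trans; m≤m+n; m≤n+m)
open import Data.Product.Base using (_×_; _,_; proj₂)
open import Data.Vec.Base using (Vec; []; _∷_; lookup; tabulate; count)
open import Data.Vec.Properties using (∷-injective)
open import Function.Bundles using (_⇔_; mk⇔)
open import Relation.Binary.PropositionalEquality using (_≡_; refl)
open import Relation.Nullary.Decidable
  using (map′; ¬?; _×-dec_; decidable-stable)
open import Relation.Unary using (Decidable)

private
  variable
    m n : ℕ

-- The left vertices are Fin m and the right vertices are Fin n.

record BipartiteGraph (m n : ℕ) : Set where
  constructor mkGraph
  field
    adjacent : Fin m → Fin n → Bool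

open BipartiteGraph public

infix 30 _*

_* : BipartiteGraph m n → BipartiteGraph n m
adjacent (G *) i j = adjacent G j i

I : BipartiteGraph m n → Fin m → Subset n
I G j = tabulate (adjacent G j)

elements : Subset m → List (Fin m)
elements {m} J = filter (_∈? J) (allFin m)

∑[_]_ : Subset m → Vec ℕ m → ℕ
∑[ J ] a = sum (map (lookup a) (elements J))

⋃[_]_ : Subset m → (Fin m → Subset n) → Subset n
⋃[ J ] S = ⋃ (map S (elements J))

Draconian : BipartiteGraph m n → Vec ℕ m → Set
Draconian {m} G a = (J : Subset m) → Nonempty J → ∑[ J ] a ≤ ∣ ⋃[ J ] I G ∣

draconian? : (G : BipartiteGraph m n) → Decidable (Draconian G)
draconian? G a = map′
  (λ none J J≠∅ → decidable-stable (∑[ J ] a ≤? ∣ ⋃[ J ] I G ∣)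
                    (λ ≰ → none (J , J≠∅ , ≰)))
  (λ { dr (J , J≠∅ , ≰) → ≰ (dr J J≠∅) })
  (¬? (anySubset? (λ J → nonempty? J ×-dec ¬? (∑[ J ] a ≤? ∣ ⋃[ J ] I G ∣))))

-- All sequences of length m with entries in {0, …, b}.

box : ℕ → (m : ℕ) → List (Vec ℕ m)
box b zero    = [] ∷ []
box b (suc m) = cartesianProductWith _∷_ (upTo (suc b)) (box b m)

-- The singletons J force every entry of a draconian sequence to be at most n,
-- so filtering the box loses nothing; ∈D⇔Draconian and D-unique show that D G
-- lists every draconian sequence exactly once.

D : BipartiteGraph m n → List (Vec ℕ m)
D {m} {n} G = filter (draconian? G) (box n m)

∈⇒≤sum : ∀ {x xs} → x List.∈ xs → x ≤ sum xs
∈⇒≤sum {x} {_ ∷ xs} (here refl) = m≤m+n x (sum xs)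
∈⇒≤sum {x} {y ∷ xs} (there x∈)  = ≤-trans (∈⇒≤sum x∈) (m≤n+m (sum xs) y)

draconian-bounded : (G : BipartiteGraph m n) {a : Vec ℕ m} →
                    Draconian G a → ∀ j → lookup a j ≤ n
draconian-bounded G {a} dr j =
  ≤-trans (∈⇒≤sum (∈-map⁺ (lookup a) (∈-filter⁺ (_∈? ⁅ j ⁆) (∈-allFin j) (x∈⁅x⁆ j))))
  (≤-trans (dr ⁅ j ⁆ (j , x∈⁅x⁆ j)) (∣p∣≤n (⋃[ ⁅ j ⁆ ] I G)))

∈-box : ∀ {b} (a : Vec ℕ m) → (∀ j → lookup a j ≤ b) → a List.∈ box b m
∈-box []      _  = here refl
∈-box (x ∷ a) ≤b = ∈-cartesianProductWith⁺ _∷_ (∈-upTo⁺ (s≤s (≤b Fin.zero)))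
                                               (∈-box a (λ j → ≤b (Fin.suc j)))

∈D⇔Draconian : (G : BipartiteGraph m n) (a : Vec ℕ m) → a List.∈ D G ⇔ Draconian G a
∈D⇔Draconian {m} {n} G a = mk⇔
  (λ a∈D → proj₂ (∈-filter⁻ (draconian? G) {xs = box n m} a∈D))
  (λ dr → ∈-filter⁺ (draconian? G) (∈-box a (draconian-bounded G {a} dr)) dr)

box-unique : ∀ b m → Unique (box b m)
box-unique b zero    = [] ∷ []
box-unique b (suc m) =
  Unique.cartesianProductWith⁺ _∷_ ∷-injective (Unique.upTo⁺ (suc b)) (box-unique b m)

D-unique : (G : BipartiteGraph m n) → Unique (D G)
D-unique {m} {n} G = Unique.filter⁺ (draconian? G) (box-unique n m)

s : Vec ℕ m → ℕ
s = count (0 <?_)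

-- Polynomials in z over ℕ: the list of coefficients, constant term first.
-- Trailing zeros are allowed, so equality of polynomials is _≈_.

Poly : Set
Poly = List ℕ

coeff : Poly → ℕ → ℕ
coeff []      _       = 0
coeff (c ∷ p) zero    = c
coeff (c ∷ p) (suc k) = coeff p k

infix 4 _≈_

_≈_ : Poly → Poly → Set
p ≈ q = ∀ k → coeff p k ≡ coeff q k

infixl 6 _⊕_

_⊕_ : Poly → Poly → Poly
[]      ⊕ q       = q
(c ∷ p) ⊕ []      = c ∷ p
(c ∷ p) ⊕ (d ∷ q) = (c + d) ∷ (p ⊕ q)

z^_ : ℕ → Poly
z^ zero    = 1 ∷ []
z^ (suc k) = 0 ∷ (z^ k)

F : BipartiteGraph m n → Poly
F G = foldr _⊕_ [] (map (λ a → z^ (s a)) (D G))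

-- The coefficient of z^k in F G counts pairs (A , a) with |A| = k and a draconian of support A.
-- For each A there are as many such a as sets B of |A| right vertices perfectly matched to A
-- (matching is always expressed by Hall's condition), and the number of matched pairs (A , B)
-- with |A| = k does not change when the two sides are swapped.
--
-- Both counts X A R (with only the right vertices in R used) obey the same recursion. Adding a
-- right vertex r to R gains exactly the objects that violate Hall's condition by one and whose
-- minimal violated set T meets the neighbourhood of r; such an object splits uniquely into a
-- part on (T , N T), counted by some c T R, and an independent object on the complement. Hence
--   X A (R + r) = X A R + Σ { c T R · X (A ∖ T) (R ∖ N T) : T ⊆ A, T meets N r }.
-- Taking for r a new vertex adjacent to a single j ∈ A, the same sum over T ∋ j is X (A ∖ j) R,
-- which determines c A R, so the recursion has a unique solution.

module Submission where

open import Defs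
import Algebra.Properties.CommutativeSemigroup as CommutativeSemigroup
open import Data.Bool.Base using (true; false; if_then_else_)
import Data.Bool.Properties as Bool
open import Data.Empty using (⊥-elim)
open import Data.Fin.Base using (Fin; zero; suc)
open import Data.Fin.Subset
open import Data.Fin.Subset.Properties
open import Data.List.Base
  using (List; []; _∷_; _++_; map; foldr; filter; length; tabulate; allFin; cartesianProduct)
import Data.List.Membership.Propositional as List
open import Data.List.Membership.Propositional.Properties
  using (∈-map⁺; ∈-map⁻; ∈-filter⁺; ∈-filter⁻; ∈-allFin; ∈-++⁺ˡ; ∈-++⁺ʳ; ∈-++⁻;
         ∈-cartesianProduct⁺; ∈-cartesianProduct⁻)
open import Data.List.Membership.Propositional.Properties.WithK using (unique∧set⇒bag)
open import Data.List.Properties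
  using (length-map; length-++; filter-accept; filter-reject; map-∘; map-tabulate)
open import Data.List.Relation.Binary.BagAndSetEquality using (∼bag⇒↭)
open import Data.List.Relation.Binary.Permutation.Propositional.Properties using (↭-length)
open import Data.List.Relation.Unary.All as All using (_∷_; [])
open import Data.List.Relation.Unary.AllPairs using ([]; _∷_)
open import Data.List.Relation.Unary.Any using (here; there)
open import Data.List.Relation.Unary.Unique.Propositional using (Unique)
import Data.List.Relation.Unary.Unique.Propositional.Properties as Unique
open import Data.Nat.Base
  using (ℕ; zero; suc; _+_; _≤_; _<_; z≤n; s≤s; _<ᵇ_) renaming (_*_ to _·_)
open import Data.Nat.ListAction using (sum)
open import Data.Nat.Properties
open import Data.Product.Base using (∃; _×_; _,_; proj₁; proj₂; swap)
open import Data.Sum.Base as Sum using (_⊎_; inj₁; inj₂; [_,_])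
open import Data.Sum.Properties using (inj₁-injective; inj₂-injective)
open import Data.Vec.Base as Vec using (Vec; []; _∷_; lookup; zipWith)
open import Data.Vec.Properties using (∷-injective; ≡-dec; lookup∘tabulate; lookup⇒[]=; []=⇒lookup)
open import Function.Base using (_∘_; id)
open import Function.Bundles using (Equivalence; mk⇔)
open import Relation.Binary.Definitions using (tri<; tri≈; tri>)
open import Relation.Binary.PropositionalEquality
  using (_≡_; _≢_; refl; sym; trans; cong; cong₂; subst; subst₂; module ≡-Reasoning)
open import Relation.Nullary using (¬_; Dec; yes; no; contradiction)
open import Relation.Nullary.Decidable using (map′; ¬?; _×-dec_; _⊎-dec_; _→-dec_; decidable-stable)
open import Relation.Unary using (Decidable)

-- Cardinalities of finite predicates

record Enumeration {X : Set} (P : X → Set) : Set where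
  field
    elems    : List X
    unique   : Unique elems
    sound    : ∀ {x} → x List.∈ elems → P x
    complete : ∀ {x} → P x → x List.∈ elems

  size : ℕ
  size = length elems

open Enumeration
open CommutativeSemigroup +-commutativeSemigroup using (interchange; x∙yz≈y∙xz)

-- Injectivity is asked only on the entries of the list, since the gluing maps used later are
-- injective only on valid objects.
map-unique : {X Y : Set} (g : Y → X) (ys : List Y) →
             (∀ {y y′} → y List.∈ ys → y′ List.∈ ys → g y ≡ g y′ → y ≡ y′) →
             Unique ys → Unique (map g ys)
map-unique g []       inj []       = []
map-unique g (y ∷ ys) inj (y∉ ∷ u) =
  All.tabulate fresh ∷ map-unique g ys (λ p q → inj (there p) (there q)) u
  where
  fresh : ∀ {x} → x List.∈ map g ys → g y ≢ x
  fresh x∈ gy≡x with ∈-map⁻ g x∈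
  ... | y′ , y′∈ , x≡gy′ =
    All.lookup y∉ y′∈ (inj (here refl) (there y′∈) (trans gy≡x x≡gy′))

-- The image of `elems eQ` and the list `elems eP` are both free of repetitions and have the same
-- members, so each is a permutation of the other.
size-bijection : {X Y : Set} {P : X → Set} {Q : Y → Set}
  (eP : Enumeration P) (eQ : Enumeration Q) (g : Y → X) →
  (∀ {y} → Q y → P (g y)) →
  (∀ {y y′} → Q y → Q y′ → g y ≡ g y′ → y ≡ y′) →
  (∀ {x} → P x → ∃ λ y → Q y × g y ≡ x) →
  size eQ ≡ size eP
size-bijection eP eQ g to inj surj = trans (sym (length-map g (elems eQ)))
  (↭-length (∼bag⇒↭ (unique∧set⇒bag
    (map-unique g (elems eQ) (λ p q → inj (sound eQ p) (sound eQ q)) (unique eQ))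
    (unique eP) (mk⇔ fwd bwd))))
  where
  fwd : ∀ {x} → x List.∈ map g (elems eQ) → x List.∈ elems eP
  fwd x∈ with ∈-map⁻ g x∈
  ... | y , y∈ , refl = complete eP (to (sound eQ y∈))
  bwd : ∀ {x} → x List.∈ elems eP → x List.∈ map g (elems eQ)
  bwd x∈ with surj (sound eP x∈)
  ... | y , q , refl = ∈-map⁺ g (complete eQ q)

size-cong : {X : Set} {P Q : X → Set} (eP : Enumeration P) (eQ : Enumeration Q) →
            (∀ {x} → P x → Q x) → (∀ {x} → Q x → P x) → size eP ≡ size eQ
size-cong eP eQ to from =
  size-bijection eQ eP id to (λ _ _ → id) (λ q → _ , from q , refl)

size-empty : {X : Set} {P : X → Set} (e : Enumeration P) → (∀ {x} → ¬ P x) → size e ≡ 0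
size-empty e none with elems e | sound e
... | []    | _ = refl
... | _ ∷ _ | p = contradiction (p (here refl)) none

size-singleton : {X : Set} {P : X → Set} (e : Enumeration P) (x : X) → P x →
                 (∀ {y} → P y → y ≡ x) → size e ≡ 1
size-singleton e x p only = size-cong e single (here ∘ only) (λ { (here refl) → p })
  where
  single : Enumeration (List._∈ (x ∷ []))
  single = record { elems = x ∷ [] ; unique = [] ∷ [] ; sound = id ; complete = id }

enum-filter : {X : Set} {P : X → Set} (xs : List X) → Unique xs → Decidable P →
              (∀ {x} → P x → x List.∈ xs) → Enumeration P
enum-filter xs u P? all = record
  { elems    = filter P? xs
  ; unique   = Unique.filter⁺ P? u
  ; sound    = λ x∈ → proj₂ (∈-filter⁻ P? {xs = xs} x∈)
  ; complete = λ p → ∈-filter⁺ P? (all p) p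
  }

Either : {X Y : Set} (P : X → Set) (Q : Y → Set) → X ⊎ Y → Set
Either P Q = [ P , Q ]

enum-⊎ : {X Y : Set} {P : X → Set} {Q : Y → Set} →
         Enumeration P → Enumeration Q → Enumeration (Either P Q)
enum-⊎ {X} {Y} {P} {Q} eP eQ = record
  { elems    = map inj₁ (elems eP) ++ map inj₂ (elems eQ)
  ; unique   = Unique.++⁺ (Unique.map⁺ inj₁-injective (unique eP))
                          (Unique.map⁺ inj₂-injective (unique eQ)) disjoint
  ; sound    = λ {x} → snd x
  ; complete = λ {x} → cmp x
  }
  where
  disjoint : ∀ {x} → ¬ (x List.∈ map inj₁ (elems eP) × x List.∈ map inj₂ (elems eQ))
  disjoint (p , q) with ∈-map⁻ inj₁ p | ∈-map⁻ inj₂ q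
  ... | _ , _ , refl | _ , _ , ()
  snd : ∀ x → x List.∈ (map inj₁ (elems eP) ++ map inj₂ (elems eQ)) → Either P Q x
  snd x x∈ with ∈-++⁻ (map inj₁ (elems eP)) x∈
  ... | inj₁ p with ∈-map⁻ inj₁ p
  ...   | _ , y∈ , refl = sound eP y∈
  snd x x∈ | inj₂ q with ∈-map⁻ inj₂ q
  ...   | _ , y∈ , refl = sound eQ y∈
  cmp : ∀ x → Either P Q x → x List.∈ (map inj₁ (elems eP) ++ map inj₂ (elems eQ))
  cmp (inj₁ x) p = ∈-++⁺ˡ (∈-map⁺ inj₁ (complete eP p))
  cmp (inj₂ y) q = ∈-++⁺ʳ (map inj₁ (elems eP)) (∈-map⁺ inj₂ (complete eQ q))

size-⊎ : {X Y : Set} {P : X → Set} {Q : Y → Set} (eP : Enumeration P) (eQ : Enumeration Q) →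
         size (enum-⊎ eP eQ) ≡ size eP + size eQ
size-⊎ eP eQ = trans (length-++ (map inj₁ (elems eP)))
  (cong₂ _+_ (length-map inj₁ (elems eP)) (length-map inj₂ (elems eQ)))

Both : {X Y : Set} (P : X → Set) (Q : Y → Set) → X × Y → Set
Both P Q (x , y) = P x × Q y

enum-× : {X Y : Set} {P : X → Set} {Q : Y → Set} →
         Enumeration P → Enumeration Q → Enumeration (Both P Q)
enum-× eP eQ = record
  { elems    = cartesianProduct (elems eP) (elems eQ)
  ; unique   = Unique.cartesianProduct⁺ (unique eP) (unique eQ)
  ; sound    = λ x∈ → let p , q = ∈-cartesianProduct⁻ (elems eP) (elems eQ) x∈
                      in sound eP p , sound eQ q
  ; complete = λ (p , q) → ∈-cartesianProduct⁺ (complete eP p) (complete eQ q)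
  }

size-× : {X Y : Set} {P : X → Set} {Q : Y → Set} (eP : Enumeration P) (eQ : Enumeration Q) →
         size (enum-× eP eQ) ≡ size eP · size eQ
size-× eP eQ = go (elems eP)
  where
  go : ∀ xs → length (cartesianProduct xs (elems eQ)) ≡ length xs · size eQ
  go []       = refl
  go (x ∷ xs) = trans (length-++ (map (x ,_) (elems eQ)))
                      (cong₂ _+_ (length-map (x ,_) (elems eQ)) (go xs))

Dependent : {X Y : Set} (K : X → Set) (Q : X → Y → Set) → X × Y → Set
Dependent K Q (t , y) = K t × Q t y

dependentPairs : {X Y : Set} {Q : X → Y → Set} → (∀ t → Enumeration (Q t)) → List X → List (X × Y)
dependentPairs eQ []       = []
dependentPairs eQ (t ∷ ts) = map (t ,_) (elems (eQ t)) ++ dependentPairs eQ ts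

enum-Σ : {X Y : Set} {K : X → Set} {Q : X → Y → Set} →
         Enumeration K → (∀ t → Enumeration (Q t)) → Enumeration (Dependent K Q)
enum-Σ {X} {Y} {K} {Q} eK eQ = record
  { elems    = pairs (elems eK)
  ; unique   = pairs-unique (elems eK) (unique eK)
  ; sound    = λ x∈ → let k , q = pairs-sound (elems eK) x∈ in sound eK k , q
  ; complete = λ (k , q) → pairs-complete (elems eK) (complete eK k) q
  }
  where
  pairs = dependentPairs eQ
  pairs-sound : ∀ ts {t y} → (t , y) List.∈ pairs ts → t List.∈ ts × Q t y
  pairs-sound (t ∷ ts) p with ∈-++⁻ (map (t ,_) (elems (eQ t))) p
  ... | inj₂ q = let a , b = pairs-sound ts q in there a , b
  ... | inj₁ q with ∈-map⁻ (t ,_) q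
  ...   | _ , y∈ , refl = here refl , sound (eQ t) y∈
  pairs-complete : ∀ ts {t y} → t List.∈ ts → Q t y → (t , y) List.∈ pairs ts
  pairs-complete (t ∷ ts) (here refl) q = ∈-++⁺ˡ (∈-map⁺ (t ,_) (complete (eQ t) q))
  pairs-complete (t ∷ ts) (there t∈)  q =
    ∈-++⁺ʳ (map (t ,_) (elems (eQ t))) (pairs-complete ts t∈ q)
  pairs-unique : ∀ ts → Unique ts → Unique (pairs ts)
  pairs-unique []       []       = []
  pairs-unique (t ∷ ts) (t∉ ∷ u) =
    Unique.++⁺ (Unique.map⁺ (λ { refl → refl }) (unique (eQ t))) (pairs-unique ts u) disjoint
    where
    -- Blocks of different `t` are separated by their first coordinate.
    disjoint : ∀ {x} → ¬ (x List.∈ map (t ,_) (elems (eQ t)) × x List.∈ pairs ts)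
    disjoint (p , q) with ∈-map⁻ (t ,_) p
    ... | _ , _ , refl = All.lookup t∉ (proj₁ (pairs-sound ts q)) refl

size-Σ : {X Y : Set} {K : X → Set} {Q : X → Y → Set}
         (eK : Enumeration K) (eQ : ∀ t → Enumeration (Q t)) →
         size (enum-Σ eK eQ) ≡ sum (map (λ t → size (eQ t)) (elems eK))
size-Σ eK eQ = go (elems eK)
  where
  go : ∀ ts → length (dependentPairs eQ ts) ≡ sum (map (λ t → size (eQ t)) ts)
  go []       = refl
  go (t ∷ ts) = trans (length-++ (map (t ,_) (elems (eQ t))))
                      (cong₂ _+_ (length-map (t ,_) (elems (eQ t))) (go ts))

sum-mono-≤ : {X : Set} (f g : X → ℕ) (xs : List X) → (∀ {x} → x List.∈ xs → f x ≤ g x) →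
             sum (map f xs) ≤ sum (map g xs)
sum-mono-≤ f g []       h = z≤n
sum-mono-≤ f g (x ∷ xs) h = +-mono-≤ (h (here refl)) (sum-mono-≤ f g xs (h ∘ there))

sum-mono-< : {X : Set} (f g : X → ℕ) (xs : List X) → (∀ {x} → x List.∈ xs → f x ≤ g x) →
             ∀ {y} → y List.∈ xs → f y < g y → sum (map f xs) < sum (map g xs)
sum-mono-< f g (x ∷ xs) h (here refl) lt = +-mono-<-≤ lt (sum-mono-≤ f g xs (h ∘ there))
sum-mono-< f g (x ∷ xs) h (there y∈)  lt =
  +-mono-≤-< (h (here refl)) (sum-mono-< f g xs (h ∘ there) y∈ lt)

sum-cong : {X : Set} (f g : X → ℕ) (xs : List X) → (∀ {x} → x List.∈ xs → f x ≡ g x) →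
           sum (map f xs) ≡ sum (map g xs)
sum-cong f g xs h = ≤-antisym (sum-mono-≤ f g xs (≤-reflexive ∘ h))
                              (sum-mono-≤ g f xs (≤-reflexive ∘ sym ∘ h))

-- If the values at `y` differed, one sum would dominate the other term by term and strictly at `y`,
-- so the totals would differ. This isolates one unknown term of a sum without reordering the list.
sum-cancel : {X : Set} (f g : X → ℕ) (xs : List X) {y : X} → y List.∈ xs →
             (∀ x → x List.∈ xs → x ≡ y ⊎ f x ≡ g x) →
             sum (map f xs) ≡ sum (map g xs) → f y ≡ g y
sum-cancel f g xs {y} y∈ h eq with <-cmp (f y) (g y)
... | tri≈ _ fy≡gy _ = fy≡gy
... | tri< lt _ _ = contradiction eq (<⇒≢ (sum-mono-< f g xs le y∈ lt))
  where
  le : ∀ {x} → x List.∈ xs → f x ≤ g x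
  le x∈ with h _ x∈
  ... | inj₁ refl = <⇒≤ lt
  ... | inj₂ e    = ≤-reflexive e
... | tri> _ _ gt = contradiction (sym eq) (<⇒≢ (sum-mono-< g f xs le y∈ gt))
  where
  le : ∀ {x} → x List.∈ xs → g x ≤ f x
  le x∈ with h _ x∈
  ... | inj₁ refl = <⇒≤ gt
  ... | inj₂ e    = ≤-reflexive (sym e)

-- Subsets and weights

private
  variable
    m n : ℕ

enum-subsets : {P : Subset m → Set} → Decidable P → Enumeration P
enum-subsets {m} P? = enum-filter (subsets m) (subsets-unique m) P? (λ _ → subsets-complete _)
  where
  subsets : ∀ m → List (Subset m)
  subsets zero    = [] ∷ []
  subsets (suc m) = map (true ∷_) (subsets m) ++ map (false ∷_) (subsets m)
  subsets-complete : ∀ {m} (p : Subset m) → p List.∈ subsets m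
  subsets-complete []          = here refl
  subsets-complete (true ∷ p)  = ∈-++⁺ˡ (∈-map⁺ (true ∷_) (subsets-complete p))
  subsets-complete {suc m} (false ∷ p) =
    ∈-++⁺ʳ (map (true ∷_) (subsets m)) (∈-map⁺ (false ∷_) (subsets-complete p))
  subsets-unique : ∀ m → Unique (subsets m)
  subsets-unique zero    = [] ∷ []
  subsets-unique (suc m) =
    Unique.++⁺ (Unique.map⁺ (proj₂ ∘ ∷-injective) (subsets-unique m))
               (Unique.map⁺ (proj₂ ∘ ∷-injective) (subsets-unique m)) disjoint
    where
    disjoint : ∀ {x} → ¬ (x List.∈ map (true ∷_) (subsets m) × x List.∈ map (false ∷_) (subsets m))
    disjoint (p , q) with ∈-map⁻ (true ∷_) p | ∈-map⁻ (false ∷_) q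
    ... | _ , _ , refl | _ , _ , ()

allSubset? : {P : Subset m → Set} → Decidable P → Dec (∀ J → P J)
allSubset? P? = map′ (λ none J → decidable-stable (P? J) (λ ¬p → none (J , ¬p)))
                     (λ all (J , ¬p) → ¬p (all J))
                     (¬? (anySubset? (λ J → ¬? (P? J))))

_≟ₛ_ : (p q : Subset m) → Dec (p ≡ q)
_≟ₛ_ = ≡-dec Bool._≟_

⊈⇒∃ : {p q : Subset m} → ¬ (p ⊆ q) → ∃ λ x → x ∈ p × x ∉ q
⊈⇒∃ {p = p} {q} p⊈q with nonempty? (p ∩ ∁ q)
... | yes (x , x∈) = let x∈p , x∈∁q = x∈p∩q⁻ p (∁ q) x∈ in x , x∈p , x∈∁p⇒x∉p x∈∁q
... | no none = ⊥-elim (p⊈q λ {x} x∈p → decidable-stable (x ∈? q)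
                  (λ x∉q → none (x , x∈p∩q⁺ (x∈p , x∉p⇒x∈∁p x∉q))))

∣∣-split : (p t : Subset m) → ∣ p ∣ ≡ ∣ p ∩ t ∣ + ∣ p ∩ ∁ t ∣
∣∣-split []          []          = refl
∣∣-split (true ∷ p)  (true ∷ t)  = cong suc (∣∣-split p t)
∣∣-split (true ∷ p)  (false ∷ t) = trans (cong suc (∣∣-split p t)) (sym (+-suc _ _))
∣∣-split (false ∷ p) (true ∷ t)  = ∣∣-split p t
∣∣-split (false ∷ p) (false ∷ t) = ∣∣-split p t

∣∣≤-split : {p p₁ p₂ : Subset m} (t : Subset m) → p ∩ t ⊆ p₁ → p ∩ ∁ t ⊆ p₂ → ∣ p ∣ ≤ ∣ p₁ ∣ + ∣ p₂ ∣
∣∣≤-split {p = p} t h₁ h₂ =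
  ≤-trans (≤-reflexive (∣∣-split p t)) (+-mono-≤ (p⊆q⇒∣p∣≤∣q∣ h₁) (p⊆q⇒∣p∣≤∣q∣ h₂))

split≤∣∣ : {p p₁ p₂ : Subset m} (t : Subset m) → p₁ ⊆ p ∩ t → p₂ ⊆ p ∩ ∁ t → ∣ p₁ ∣ + ∣ p₂ ∣ ≤ ∣ p ∣
split≤∣∣ {p = p} t h₁ h₂ =
  ≤-trans (+-mono-≤ (p⊆q⇒∣p∣≤∣q∣ h₁) (p⊆q⇒∣p∣≤∣q∣ h₂)) (≤-reflexive (sym (∣∣-split p t)))

∩∁-disjoint : {p t : Subset m} {x : Fin m} → x ∈ p ∩ ∁ t → x ∉ t
∩∁-disjoint {p = p} {t} x∈ = x∈∁p⇒x∉p (p∩q⊆q p (∁ t) x∈)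

∩∁-⊂ : {p t : Subset m} → Nonempty (p ∩ t) → p ∩ ∁ t ⊂ p
∩∁-⊂ {p = p} {t} (x , x∈) = let x∈p , x∈t = x∈p∩q⁻ p t x∈ in
  p∩q⊆p p (∁ t) , x , x∈p , λ x∈′ → ∩∁-disjoint x∈′ x∈t

⊆∧≢⇒⊂ : {p q : Subset m} → p ⊆ q → p ≢ q → p ⊂ q
⊆∧≢⇒⊂ {p = p} {q} p⊆q p≢q with q ⊆? p
... | yes q⊆p = contradiction (⊆-antisym p⊆q q⊆p) p≢q
... | no  q⊈p = p⊆q , ⊈⇒∃ q⊈p

∪-cover : {t p : Subset m} → t ⊆ p → t ∪ (p ∩ ∁ t) ≡ p
∪-cover {t = t} {p} t⊆p = ⊆-antisym
  (λ x∈ → [ t⊆p , p∩q⊆p p (∁ t) ] (x∈p∪q⁻ t (p ∩ ∁ t) x∈)) back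
  where
  back : p ⊆ t ∪ (p ∩ ∁ t)
  back {x} x∈p with x ∈? t
  ... | yes x∈t = x∈p∪q⁺ (inj₁ x∈t)
  ... | no  x∉t = x∈p∪q⁺ (inj₂ (x∈p∩q⁺ (x∈p , x∉p⇒x∈∁p x∉t)))

∩-mono : {p p′ q q′ : Subset m} → p ⊆ p′ → q ⊆ q′ → p ∩ q ⊆ p′ ∩ q′
∩-mono {p = p} {q = q} f g x∈ = let a , b = x∈p∩q⁻ p q x∈ in x∈p∩q⁺ (f a , g b)

⊆⇒∩≡ : {p q : Subset m} → p ⊆ q → p ∩ q ≡ p
⊆⇒∩≡ {p = p} {q} p⊆q = ⊆-antisym (p∩q⊆p p q) (λ x∈ → x∈p∩q⁺ (x∈ , p⊆q x∈))

⁅⁆⊆ : {p : Subset m} {x : Fin m} → x ∈ p → ⁅ x ⁆ ⊆ p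
⁅⁆⊆ {p = p} {x} x∈p y∈ = subst (_∈ p) (sym (x∈⁅y⁆⇒x≡y x y∈)) x∈p

∈⇒0<∣∣ : {p : Subset m} {x : Fin m} → x ∈ p → 0 < ∣ p ∣
∈⇒0<∣∣ {x = x} x∈p = ≤-trans (≤-reflexive (sym (∣⁅x⁆∣≡1 x))) (p⊆q⇒∣p∣≤∣q∣ (⁅⁆⊆ x∈p))

∩-∪-∩∁ : (p t : Subset m) → (p ∩ t) ∪ (p ∩ ∁ t) ≡ p
∩-∪-∩∁ p t = trans (sym (∩-distribˡ-∪ p t (∁ t)))
                   (trans (cong (p ∩_) (p∪∁p≡⊤ t)) (∩-identityʳ p))

-- This is `∑[ J ] a` by recursion along the two vectors, a form that computes in inductive proofs;
-- `∑≡wt` links the two.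
wt : Subset m → Vec ℕ m → ℕ
wt []          []      = 0
wt (true ∷ J)  (x ∷ a) = x + wt J a
wt (false ∷ J) (x ∷ a) = wt J a

mask : Subset m → Vec ℕ m → Vec ℕ m
mask = zipWith (λ b x → if b then x else 0)

supp : Vec ℕ m → Subset m
supp = Vec.map (0 <ᵇ_)

indicator : Subset m → Vec ℕ m
indicator = Vec.map (λ b → if b then 1 else 0)

_⊞_ : Vec ℕ m → Vec ℕ m → Vec ℕ m
_⊞_ = zipWith _+_

wt-split : (J T : Subset m) (w : Vec ℕ m) → wt J w ≡ wt (J ∩ T) w + wt (J ∩ ∁ T) w
wt-split []          []          []      = refl
wt-split (true ∷ J)  (true ∷ T)  (x ∷ w) = trans (cong (x +_) (wt-split J T w)) (sym (+-assoc x _ _))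
wt-split (true ∷ J)  (false ∷ T) (x ∷ w) =
  trans (cong (x +_) (wt-split J T w)) (x∙yz≈y∙xz x (wt (J ∩ T) w) _)
wt-split (false ∷ J) (true ∷ T)  (x ∷ w) = wt-split J T w
wt-split (false ∷ J) (false ∷ T) (x ∷ w) = wt-split J T w

wt-mask : (J K : Subset m) (w : Vec ℕ m) → wt J (mask K w) ≡ wt (J ∩ K) w
wt-mask []          []          []      = refl
wt-mask (true ∷ J)  (true ∷ K)  (x ∷ w) = cong (x +_) (wt-mask J K w)
wt-mask (true ∷ J)  (false ∷ K) (x ∷ w) = wt-mask J K w
wt-mask (false ∷ J) (_ ∷ K)     (x ∷ w) = wt-mask J K w

wt-supp : (J : Subset m) (w : Vec ℕ m) → wt (J ∩ supp w) w ≡ wt J w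
wt-supp []          []          = refl
wt-supp (true ∷ J)  (zero ∷ w)  = wt-supp J w
wt-supp (true ∷ J)  (suc x ∷ w) = cong (suc x +_) (wt-supp J w)
wt-supp (false ∷ J) (x ∷ w)     = wt-supp J w

wt-indicator : (J A : Subset m) → wt J (indicator A) ≡ ∣ J ∩ A ∣
wt-indicator []          []          = refl
wt-indicator (true ∷ J)  (true ∷ A)  = cong suc (wt-indicator J A)
wt-indicator (true ∷ J)  (false ∷ A) = wt-indicator J A
wt-indicator (false ∷ J) (_ ∷ A)     = wt-indicator J A

wt-⊞ : (J : Subset m) (a b : Vec ℕ m) → wt J (a ⊞ b) ≡ wt J a + wt J b
wt-⊞ []          []      []      = refl
wt-⊞ (true ∷ J)  (x ∷ a) (y ∷ b) = trans (cong (x + y +_) (wt-⊞ J a b)) (interchange x y _ _)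
wt-⊞ (false ∷ J) (x ∷ a) (y ∷ b) = wt-⊞ J a b

wt-⊥ : (w : Vec ℕ m) → wt ⊥ w ≡ 0
wt-⊥ []      = refl
wt-⊥ (x ∷ w) = wt-⊥ w

lookup≤wt⊤ : (w : Vec ℕ m) (j : Fin m) → lookup w j ≤ wt ⊤ w
lookup≤wt⊤ (x ∷ w) zero    = m≤m+n x _
lookup≤wt⊤ (x ∷ w) (suc j) = ≤-trans (lookup≤wt⊤ w j) (m≤n+m _ x)

supp-indicator : (A : Subset m) → supp (indicator A) ≡ A
supp-indicator []          = refl
supp-indicator (true ∷ A)  = cong (true ∷_) (supp-indicator A)
supp-indicator (false ∷ A) = cong (false ∷_) (supp-indicator A)

supp-mask : (K : Subset m) (w : Vec ℕ m) → supp (mask K w) ≡ supp w ∩ K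
supp-mask []          []      = refl
supp-mask (true ∷ K)  (x ∷ w) = cong₂ _∷_ (sym (Bool.∧-identityʳ _)) (supp-mask K w)
supp-mask (false ∷ K) (x ∷ w) = cong₂ _∷_ (sym (Bool.∧-zeroʳ _)) (supp-mask K w)

mask-indicator : (K A : Subset m) → mask K (indicator A) ≡ indicator (A ∩ K)
mask-indicator []          []          = refl
mask-indicator (true ∷ K)  (true ∷ A)  = cong (1 ∷_) (mask-indicator K A)
mask-indicator (true ∷ K)  (false ∷ A) = cong (0 ∷_) (mask-indicator K A)
mask-indicator (false ∷ K) (true ∷ A)  = cong (0 ∷_) (mask-indicator K A)
mask-indicator (false ∷ K) (false ∷ A) = cong (0 ∷_) (mask-indicator K A)

mask-⊞ : (T : Subset m) (w : Vec ℕ m) → mask T w ⊞ mask (∁ T) w ≡ w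
mask-⊞ []          []      = refl
mask-⊞ (true ∷ T)  (x ∷ w) = cong₂ _∷_ (+-identityʳ x) (mask-⊞ T w)
mask-⊞ (false ∷ T) (x ∷ w) = cong (x ∷_) (mask-⊞ T w)

supp-⊞ : (a b : Vec ℕ m) → supp (a ⊞ b) ≡ supp a ∪ supp b
supp-⊞ []          []      = refl
supp-⊞ (zero ∷ a)  (y ∷ b) = cong (_ ∷_) (supp-⊞ a b)
supp-⊞ (suc x ∷ a) (y ∷ b) = cong (true ∷_) (supp-⊞ a b)

-- The hypothesis makes the supports of `a` and `b` disjoint, so two positive heads in the same
-- place are absurd. It is phrased with `A` because `IsPair` delivers it in this form.
mask-left : (A : Subset m) (a b : Vec ℕ m) → supp b ≡ A ∩ ∁ (supp a) → mask (supp a) (a ⊞ b) ≡ a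
mask-left []      []          []          eq = refl
mask-left (_ ∷ A) (zero ∷ a)  (y ∷ b)     eq = cong (0 ∷_) (mask-left A a b (proj₂ (∷-injective eq)))
mask-left (_ ∷ A) (suc x ∷ a) (zero ∷ b)  eq =
  cong₂ _∷_ (+-identityʳ (suc x)) (mask-left A a b (proj₂ (∷-injective eq)))
mask-left (true ∷ A)  (suc x ∷ a) (suc y ∷ b) ()
mask-left (false ∷ A) (suc x ∷ a) (suc y ∷ b) ()

mask-right : (A : Subset m) (a b : Vec ℕ m) → supp b ≡ A ∩ ∁ (supp a) → mask (∁ (supp a)) (a ⊞ b) ≡ b
mask-right []      []          []          eq = refl
mask-right (_ ∷ A) (zero ∷ a)  (y ∷ b)     eq = cong (y ∷_) (mask-right A a b (proj₂ (∷-injective eq)))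
mask-right (_ ∷ A) (suc x ∷ a) (zero ∷ b)  eq = cong (0 ∷_) (mask-right A a b (proj₂ (∷-injective eq)))
mask-right (true ∷ A)  (suc x ∷ a) (suc y ∷ b) ()
mask-right (false ∷ A) (suc x ∷ a) (suc y ∷ b) ()

wt⊤≡wt-supp : (a : Vec ℕ m) → wt ⊤ a ≡ wt (supp a) a
wt⊤≡wt-supp a = trans (sym (wt-supp ⊤ a)) (cong (λ J → wt J a) (∩-identityˡ (supp a)))

supp-positive : (a : Vec ℕ m) {j : Fin m} → j ∈ supp a → 0 < lookup a j
supp-positive (suc x ∷ a) {zero}  _  = s≤s z≤n
supp-positive (x ∷ a)     {suc j} j∈ = supp-positive a (drop-there j∈)

⊞-cancelʳ : (a b c : Vec ℕ m) → a ⊞ c ≡ b ⊞ c → a ≡ b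
⊞-cancelʳ []      []      []      eq = refl
⊞-cancelʳ (x ∷ a) (y ∷ b) (z ∷ c) eq = let p , q = ∷-injective eq in
  cong₂ _∷_ (+-cancelʳ-≡ z x y p) (⊞-cancelʳ a b c q)

⊞-⊥ : (a : Vec ℕ m) → a ⊞ indicator ⊥ ≡ a
⊞-⊥ []      = refl
⊞-⊥ (x ∷ a) = cong₂ _∷_ (+-identityʳ x) (⊞-⊥ a)

decrement : (a : Vec ℕ m) (i : Fin m) → i ∈ supp a → ∃ λ b → b ⊞ indicator ⁅ i ⁆ ≡ a
decrement (suc x ∷ a) zero    _  = x ∷ a , cong₂ _∷_ (+-comm x 1) (⊞-⊥ a)
decrement (x ∷ a)     (suc i) i∈ = let b , eq = decrement a i (drop-there i∈) in
  x ∷ b , cong₂ _∷_ (+-identityʳ x) eq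

supp≡⊥ : (a : Vec ℕ m) → supp a ≡ ⊥ → a ≡ indicator ⊥
supp≡⊥ []         eq = refl
supp≡⊥ (zero ∷ a) eq = cong (0 ∷_) (supp≡⊥ a (proj₂ (∷-injective eq)))

-- Violated sets

∈⋃⁺ : {p : Subset n} {ps : List (Subset n)} {r : Fin n} → p List.∈ ps → r ∈ p → r ∈ ⋃ ps
∈⋃⁺ {ps = p ∷ ps} (here refl) r∈p = p⊆p∪q (⋃ ps) r∈p
∈⋃⁺ {ps = p ∷ ps} (there p∈)  r∈p = q⊆p∪q p (⋃ ps) (∈⋃⁺ p∈ r∈p)

∈⋃⁻ : (ps : List (Subset n)) {r : Fin n} → r ∈ ⋃ ps → ∃ λ p → p List.∈ ps × r ∈ p
∈⋃⁻ []       r∈ = contradiction r∈ ∉⊥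
∈⋃⁻ (p ∷ ps) r∈ with x∈p∪q⁻ p (⋃ ps) r∈
... | inj₁ r∈p = p , here refl , r∈p
... | inj₂ r∈⋃ = let q , q∈ , r∈q = ∈⋃⁻ ps r∈⋃ in q , there q∈ , r∈q

Meets : Subset m → Subset m → Set
Meets J S = Nonempty (J ∩ S)

module _ {m n : ℕ} (G : BipartiteGraph m n) where

  ∈I⁺ : ∀ {j r} → adjacent G j r ≡ true → r ∈ I G j
  ∈I⁺ {j} {r} eq = lookup⇒[]= r _ (trans (lookup∘tabulate (adjacent G j) r) eq)

  ∈I⁻ : ∀ {j r} → r ∈ I G j → adjacent G j r ≡ true
  ∈I⁻ {j} {r} r∈ = trans (sym (lookup∘tabulate (adjacent G j) r)) ([]=⇒lookup r∈)

module _ {m n : ℕ} (G : BipartiteGraph m n) where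

  ∈I*⁺ : ∀ {j r} → r ∈ I G j → j ∈ I (G *) r
  ∈I*⁺ r∈ = ∈I⁺ (G *) (∈I⁻ G r∈)

  N : Subset m → Subset n
  N J = ⋃[ J ] I G

  ∈N⁺ : ∀ {J j r} → j ∈ J → r ∈ I G j → r ∈ N J
  ∈N⁺ {J} {j} j∈J r∈ = ∈⋃⁺ (∈-map⁺ (I G) (∈-filter⁺ (_∈? J) (∈-allFin j) j∈J)) r∈

  ∈N⁻ : ∀ J {r} → r ∈ N J → ∃ λ j → j ∈ J × r ∈ I G j
  ∈N⁻ J r∈ with ∈⋃⁻ (map (I G) (elements J)) r∈
  ... | p , p∈ , r∈p with ∈-map⁻ (I G) p∈
  ...   | j , j∈ , refl = j , proj₂ (∈-filter⁻ (_∈? J) {xs = allFin m} j∈) , r∈p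

  N-mono : ∀ {J K} → J ⊆ K → N J ⊆ N K
  N-mono {J} J⊆K r∈ = let j , j∈ , adj = ∈N⁻ J r∈ in ∈N⁺ (J⊆K j∈) adj

  -- The right-hand side of Hall's condition when only the right vertices in `Q` are available.
  hi : Subset n → Subset m → ℕ
  hi Q J = ∣ N J ∩ Q ∣

  hi-mono : ∀ {Q Q′ J J′} → Q ⊆ Q′ → J ⊆ J′ → hi Q J ≤ hi Q′ J′
  hi-mono {Q} {Q′} {J} {J′} Q⊆ J⊆ =
    p⊆q⇒∣p∣≤∣q∣ (∩-mono {p = N J} {p′ = N J′} {q = Q} {q′ = Q′} (N-mono J⊆) Q⊆)

  -- An available neighbour of `J ∪ T` either lies in `N T` or, being outside it, must be a
  -- neighbour of `J`.
  hi-∪ : ∀ Q J T → hi Q (J ∪ T) ≤ hi Q T + hi (Q ∩ ∁ (N T)) J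
  hi-∪ Q J T = ∣∣≤-split (N T) inside-T outside-T
    where
    inside-T : (N (J ∪ T) ∩ Q) ∩ N T ⊆ N T ∩ Q
    inside-T x∈ = let a , b = x∈p∩q⁻ (N (J ∪ T) ∩ Q) (N T) x∈ in
      x∈p∩q⁺ (b , proj₂ (x∈p∩q⁻ (N (J ∪ T)) Q a))
    outside-T : (N (J ∪ T) ∩ Q) ∩ ∁ (N T) ⊆ N J ∩ (Q ∩ ∁ (N T))
    outside-T x∈ with x∈p∩q⁻ (N (J ∪ T) ∩ Q) (∁ (N T)) x∈
    ... | x∈NQ , x∉NT with x∈p∩q⁻ (N (J ∪ T)) Q x∈NQ
    ... | x∈N , x∈Q with ∈N⁻ (J ∪ T) x∈N
    ... | j , j∈ , adj with x∈p∪q⁻ J T j∈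
    ... | inj₁ j∈J = x∈p∩q⁺ (∈N⁺ j∈J adj , x∈p∩q⁺ (x∈Q , x∉NT))
    ... | inj₂ j∈T = contradiction (∈N⁺ j∈T adj) (x∈∁p⇒x∉p x∉NT)

  -- Neighbours of `K` lie in `N T`, so the two terms count disjoint sets of available neighbours of
  -- `J`.
  hi-+ : ∀ Q {J K T} → K ⊆ T → K ⊆ J → hi Q K + hi (Q ∩ ∁ (N T)) J ≤ hi Q J
  hi-+ Q {J} {K} {T} K⊆T K⊆J = split≤∣∣ (N T) inside-T outside-T
    where
    inside-T : N K ∩ Q ⊆ (N J ∩ Q) ∩ N T
    inside-T x∈ = let a , b = x∈p∩q⁻ (N K) Q x∈ in
      x∈p∩q⁺ (x∈p∩q⁺ (N-mono K⊆J a , b) , N-mono K⊆T a)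
    outside-T : N J ∩ (Q ∩ ∁ (N T)) ⊆ (N J ∩ Q) ∩ ∁ (N T)
    outside-T x∈ = let a , b = x∈p∩q⁻ (N J) (Q ∩ ∁ (N T)) x∈
                       c , d = x∈p∩q⁻ Q (∁ (N T)) b in x∈p∩q⁺ (x∈p∩q⁺ (a , c) , d)

  -- Hall's condition with demand `w` and supply `Q`. For `Q = ⊤` it is the draconian condition; for
  -- an indicator it expresses that a set can be matched into `Q`.
  Ind : Vec ℕ m → Subset n → Set
  Ind w Q = ∀ J → wt J w ≤ hi Q J

  -- Independence after adding to Q one more right vertex with neighbourhood S.
  IndS : Subset m → Vec ℕ m → Subset n → Set
  IndS S w Q = ∀ J → wt J w ≤ hi Q J ⊎ (Meets J S × wt J w ≤ suc (hi Q J))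

  -- A minimal violated set whose excess is exactly one.
  Tight : Subset m → Vec ℕ m → Subset n → Set
  Tight T w Q = wt T w ≡ suc (hi Q T) × (∀ U → U ⊂ T → wt U w ≤ hi Q U)

  -- Deleting `T` together with `N T` must leave an independent remainder. This makes `T` the unique
  -- minimal violated set, along which an object is cut in two.
  Critical : Subset m → Vec ℕ m → Subset n → Set
  Critical T w Q = Tight T w Q × Ind (mask (∁ T) w) (Q ∩ ∁ (N T))

  ind? : ∀ w Q → Dec (Ind w Q)
  ind? w Q = allSubset? (λ J → wt J w ≤? hi Q J)

  indS? : ∀ S w Q → Dec (IndS S w Q)
  indS? S w Q = allSubset? (λ J → wt J w ≤? hi Q J ⊎-dec
                                   (nonempty? (J ∩ S) ×-dec wt J w ≤? suc (hi Q J)))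

  tight? : ∀ T w Q → Dec (Tight T w Q)
  tight? T w Q = wt T w ≟ suc (hi Q T) ×-dec
                 allSubset? (λ U → (U ⊂? T) →-dec (wt U w ≤? hi Q U))

  -- Tightness inspects only subsets of `T`, so `w` and `Q` may be changed wherever those subsets do
  -- not see it.
  tight-cong : ∀ {T w w′ Q Q′} → (∀ {U} → U ⊆ T → wt U w ≡ wt U w′) →
               (∀ {U} → U ⊆ T → hi Q U ≡ hi Q′ U) → Tight T w Q → Tight T w′ Q′
  tight-cong w≗ hi≗ (eq , below) =
    trans (sym (w≗ ⊆-refl)) (trans eq (cong suc (hi≗ ⊆-refl))) ,
    λ U U⊂T → subst₂ _≤_ (w≗ (p⊂q⇒p⊆q U⊂T)) (hi≗ (p⊂q⇒p⊆q U⊂T)) (below U U⊂T)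

  tight-mask : ∀ {T w Q} → Tight T w Q → Tight T (mask T w) Q
  tight-mask {T} {w} = tight-cong
    (λ {U} U⊆T → sym (trans (wt-mask U T w) (cong (λ V → wt V w) (⊆⇒∩≡ U⊆T)))) (λ _ → refl)

  tight-unmask : ∀ {T w Q} → Tight T (mask T w) Q → Tight T w Q
  tight-unmask {T} {w} = tight-cong
    (λ {U} U⊆T → trans (wt-mask U T w) (cong (λ V → wt V w) (⊆⇒∩≡ U⊆T))) (λ _ → refl)

  -- Discarding the zero coordinates of `T` keeps its weight and cannot enlarge its neighbourhood,
  -- so it would leave a proper subset that is still violated.
  tight⊆supp : ∀ {T w Q} → Tight T w Q → T ⊆ supp w
  tight⊆supp {T} {w} {Q} (eq , below) with T ⊆? supp w
  ... | yes T⊆ = T⊆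
  ... | no T⊈ = let x , x∈ , x∉ = ⊈⇒∃ T⊈ in
    contradiction
      (≤-trans (below (T ∩ supp w) (p∩q⊆p T _ , x , x∈ , x∉ ∘ p∩q⊆q T _))
               (hi-mono {Q} ⊆-refl (p∩q⊆p T (supp w))))
      (<⇒≱ (≤-reflexive (trans (sym eq) (sym (wt-supp T w)))))

  -- Cut `J` along `T`: the part inside is a proper subset of `T`, hence not violated, and the part
  -- outside is controlled by the independent remainder. So every violated set contains `T`.
  critical-bound : ∀ {T w Q} → Critical T w Q → ∀ J → ¬ (T ⊆ J) → wt J w ≤ hi Q J
  critical-bound {T} {w} {Q} ((_ , below) , ind) J T⊈J = begin
    wt J w                                    ≡⟨ wt-split J T w ⟩
    wt (J ∩ T) w + wt (J ∩ ∁ T) w             ≡⟨ cong (wt (J ∩ T) w +_) (wt-mask J (∁ T) w) ⟨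
    wt (J ∩ T) w + wt J (mask (∁ T) w)        ≤⟨ +-mono-≤ (below (J ∩ T) J∩T⊂T) (ind J) ⟩
    hi Q (J ∩ T) + hi (Q ∩ ∁ (N T)) J         ≤⟨ hi-+ Q (p∩q⊆q J T) (p∩q⊆p J T) ⟩
    hi Q J                                    ∎
    where
    open ≤-Reasoning
    J∩T⊂T : J ∩ T ⊂ T
    J∩T⊂T = let x , x∈ , x∉ = ⊈⇒∃ T⊈J in p∩q⊆q J T , x , x∈ , x∉ ∘ p∩q⊆p J T

  -- Only sets containing `T` can be violated. They inherit from `T` both the meeting with `S` and
  -- an excess of at most one.
  critical-indS : ∀ {S T w Q} → Meets T S → Critical T w Q → IndS S w Q
  critical-indS {S} {T} {w} {Q} (x , x∈) crit@((eq , _) , ind) J with T ⊆? J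
  ... | no T⊈J = inj₁ (critical-bound crit J T⊈J)
  ... | yes T⊆J = inj₂ ((x , ∩-mono {p = T} {q = S} T⊆J id x∈) , (begin
    wt J w                                    ≡⟨ wt-split J T w ⟩
    wt (J ∩ T) w + wt (J ∩ ∁ T) w             ≡⟨ cong (wt (J ∩ T) w +_) (wt-mask J (∁ T) w) ⟨
    wt (J ∩ T) w + wt J (mask (∁ T) w)        ≡⟨ cong (λ K → wt K w + wt J (mask (∁ T) w)) J∩T≡T ⟩
    wt T w + wt J (mask (∁ T) w)              ≤⟨ +-mono-≤ (≤-reflexive eq) (ind J) ⟩
    suc (hi Q T + hi (Q ∩ ∁ (N T)) J)         ≤⟨ s≤s (hi-+ Q ⊆-refl T⊆J) ⟩
    suc (hi Q J)                              ∎))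
    where
    open ≤-Reasoning
    J∩T≡T : J ∩ T ≡ T
    J∩T≡T = trans (∩-comm J T) (⊆⇒∩≡ T⊆J)

  critical-¬ind : ∀ {T w Q} → Critical T w Q → ¬ Ind w Q
  critical-¬ind {T} ((eq , _) , _) ind = <⇒≱ (≤-reflexive (sym eq)) (ind T)

  -- Each of the two sets is violated, so by `critical-bound` each contains the other.
  critical-unique : ∀ {T T′ w Q} → Critical T w Q → Critical T′ w Q → T ≡ T′
  critical-unique c c′ = ⊆-antisym (one c c′) (one c′ c)
    where
    one : ∀ {T T′ w Q} → Critical T w Q → Critical T′ w Q → T ⊆ T′
    one {T} {T′} c ((eq , _) , _) with T ⊆? T′
    ... | yes T⊆T′ = T⊆T′
    ... | no T⊈T′ = contradiction (critical-bound c T′ T⊈T′) (<⇒≱ (≤-reflexive (sym eq)))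

  minimal-violated : ∀ w Q k J → ∣ J ∣ ≤ k → ¬ (wt J w ≤ hi Q J) →
                     ∃ λ T → ¬ (wt T w ≤ hi Q T) × (∀ U → U ⊂ T → wt U w ≤ hi Q U)
  minimal-violated w Q k J ∣J∣≤k bad
    with anySubset? (λ U → (U ⊂? J) ×-dec ¬? (wt U w ≤? hi Q U))
  ... | no none = J , bad , λ U U⊂J →
    decidable-stable (wt U w ≤? hi Q U) (λ badU → none (U , U⊂J , badU))
  -- `k` bounds `∣ J ∣`; it drops at each passage to a proper subset, which makes the descent
  -- terminate.
  minimal-violated w Q zero J ∣J∣≤0 bad | yes (U , U⊂J , badU) =
    contradiction (≤-trans (p⊂q⇒∣p∣<∣q∣ U⊂J) ∣J∣≤0) (λ ())
  minimal-violated w Q (suc k) J ∣J∣≤k bad | yes (U , U⊂J , badU) =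
    minimal-violated w Q k U (≤-pred (≤-trans (p⊂q⇒∣p∣<∣q∣ U⊂J) ∣J∣≤k)) badU

  -- If some set is violated, take a minimal one, `T`. `IndS` at `T` forces it to meet `S` and to
  -- have excess exactly one, so `T` is tight; the remainder is independent because `T` already uses
  -- up the whole allowed excess.
  indS-cases : ∀ {S w Q} → IndS S w Q → Ind w Q ⊎ ∃ λ T → Meets T S × Critical T w Q
  indS-cases {S} {w} {Q} indS with anySubset? (λ J → ¬? (wt J w ≤? hi Q J))
  ... | no none = inj₁ λ J → decidable-stable (wt J w ≤? hi Q J) (λ bad → none (J , bad))
  ... | yes (J , badJ) with minimal-violated w Q ∣ J ∣ J ≤-refl badJ
  ... | T , bad , below with indS T
  ... | inj₁ good = contradiction good bad
  ... | inj₂ (meets , T≤) = inj₂ (T , meets , (eq , below) , ind)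
    where
    eq : wt T w ≡ suc (hi Q T)
    eq = ≤-antisym T≤ (≰⇒> bad)
    ind : Ind (mask (∁ T) w) (Q ∩ ∁ (N T))
    -- Apply the weakened Hall condition to `J ∪ T` and cancel the contribution `suc (hi Q T)` of
    -- `T` from both sides.
    ind J = +-cancelˡ-≤ (suc (hi Q T)) _ _ (begin
      suc (hi Q T) + wt J (mask (∁ T) w)       ≡⟨ cong (_+ wt J (mask (∁ T) w)) eq ⟨
      wt T w + wt J (mask (∁ T) w)             ≡⟨ cong (wt T w +_) (wt-mask J (∁ T) w) ⟩
      wt T w + wt (J ∩ ∁ T) w                  ≡⟨ cong₂ (λ K L → wt K w + wt L w) K∩T K∩∁T ⟨
      wt ((J ∪ T) ∩ T) w + wt ((J ∪ T) ∩ ∁ T) w ≡⟨ wt-split (J ∪ T) T w ⟨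
      wt (J ∪ T) w                             ≤⟨ [ m≤n⇒m≤1+n , proj₂ ] (indS (J ∪ T)) ⟩
      suc (hi Q (J ∪ T))                       ≤⟨ s≤s (hi-∪ Q J T) ⟩
      suc (hi Q T) + hi (Q ∩ ∁ (N T)) J        ∎)
      where
      open ≤-Reasoning
      K∩T : (J ∪ T) ∩ T ≡ T
      K∩T = trans (∩-comm (J ∪ T) T) (⊆⇒∩≡ (q⊆p∪q J T))
      K∩∁T : (J ∪ T) ∩ ∁ T ≡ J ∩ ∁ T
      K∩∁T = trans (∩-distribʳ-∪ (∁ T) J T)
               (trans (cong (J ∩ ∁ T ∪_) (∩-inverseʳ T)) (∪-identityʳ (J ∩ ∁ T)))

  -- A new right vertex `r` raises the supply of `J` by one when `J` meets the neighbourhood of `r`,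
  -- and otherwise leaves it unchanged.
  ind-cong-indS : ∀ {r R w} → r ∉ R → (Ind w (R ∪ ⁅ r ⁆) → IndS (I (G *) r) w R) ×
                                     (IndS (I (G *) r) w R → Ind w (R ∪ ⁅ r ⁆))
  ind-cong-indS {r} {R} {w} r∉R = to , from
    where
    S = I (G *) r
    ⊆without : ∀ J → ¬ Meets J S → N J ∩ (R ∪ ⁅ r ⁆) ⊆ N J ∩ R
    ⊆without J none x∈ with x∈p∩q⁻ (N J) (R ∪ ⁅ r ⁆) x∈
    ... | x∈N , x∈∪ with x∈p∪q⁻ R ⁅ r ⁆ x∈∪
    ... | inj₁ x∈R = x∈p∩q⁺ (x∈N , x∈R)
    ... | inj₂ x∈r with x∈⁅y⁆⇒x≡y r x∈r
    ... | refl = let j , j∈ , adj = ∈N⁻ J x∈N in ⊥-elim (none (j , x∈p∩q⁺ (j∈ , ∈I*⁺ adj)))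
    ≤suc : ∀ J → hi (R ∪ ⁅ r ⁆) J ≤ suc (hi R J)
    ≤suc J = ≤-trans (∣∣≤-split {p₁ = ⁅ r ⁆} {p₂ = N J ∩ R} ⁅ r ⁆ (p∩q⊆q _ _) rest)
                     (≤-reflexive (cong (_+ hi R J) (∣⁅x⁆∣≡1 r)))
      where
      rest : (N J ∩ (R ∪ ⁅ r ⁆)) ∩ ∁ ⁅ r ⁆ ⊆ N J ∩ R
      rest x∈ with x∈p∩q⁻ (N J ∩ (R ∪ ⁅ r ⁆)) (∁ ⁅ r ⁆) x∈
      ... | a , b with x∈p∩q⁻ (N J) (R ∪ ⁅ r ⁆) a
      ... | c , d with x∈p∪q⁻ R ⁅ r ⁆ d
      ... | inj₁ e = x∈p∩q⁺ (c , e)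
      ... | inj₂ e = contradiction e (x∈∁p⇒x∉p b)
    to : Ind w (R ∪ ⁅ r ⁆) → IndS S w R
    to ind J with nonempty? (J ∩ S)
    ... | yes meets = inj₂ (meets , ≤-trans (ind J) (≤suc J))
    ... | no none = inj₁ (≤-trans (ind J) (p⊆q⇒∣p∣≤∣q∣ (⊆without J none)))
    suc≤ : ∀ J → Meets J S → suc (hi R J) ≤ hi (R ∪ ⁅ r ⁆) J
    suc≤ J (j , j∈) = ≤-trans (≤-reflexive (cong (_+ hi R J) (sym (∣⁅x⁆∣≡1 r))))
      (split≤∣∣ ⁅ r ⁆ new old)
      where
      r∈N : r ∈ N J
      r∈N = let a , b = x∈p∩q⁻ J S j∈ in ∈N⁺ a (∈I⁺ G (∈I⁻ (G *) b))
      new : ⁅ r ⁆ ⊆ (N J ∩ (R ∪ ⁅ r ⁆)) ∩ ⁅ r ⁆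
      new x∈ with x∈⁅y⁆⇒x≡y r x∈
      ... | refl = x∈p∩q⁺ (x∈p∩q⁺ (r∈N , q⊆p∪q R ⁅ r ⁆ x∈) , x∈)
      old : N J ∩ R ⊆ (N J ∩ (R ∪ ⁅ r ⁆)) ∩ ∁ ⁅ r ⁆
      old x∈ = let a , b = x∈p∩q⁻ (N J) R x∈ in
        x∈p∩q⁺ (x∈p∩q⁺ (a , p⊆p∪q ⁅ r ⁆ b) ,
                x∉p⇒x∈∁p (λ x∈r → r∉R (subst (_∈ R) (x∈⁅y⁆⇒x≡y r x∈r) b)))
    from : IndS S w R → Ind w (R ∪ ⁅ r ⁆)
    from indS J with indS J
    ... | inj₁ le = ≤-trans le (hi-mono (p⊆p∪q ⁅ r ⁆) ⊆-refl)
    ... | inj₂ (meets , le) = ≤-trans le (suc≤ J meets)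

  -- Counting recurrences

  Below : Subset m → Subset m → Subset m → Set
  Below A S T = T ⊆ A × Meets T S

  enum-below : ∀ A S → Enumeration (Below A S)
  enum-below A S = enum-subsets (λ T → (T ⊆? A) ×-dec nonempty? (T ∩ S))

  convolution : (c x : Subset m → Subset n → ℕ) → Subset m → Subset m → Subset n → ℕ
  convolution c x A S R =
    sum (map (λ T → c T R · x (A ∩ ∁ T) (R ∩ ∁ (N T))) (elems (enum-below A S)))

  -- `left` encodes a fresh right vertex whose only neighbour is `j`, without enlarging the graph:
  -- the sets meeting `⁅ j ⁆` are those containing `j`.
  record Recurrence (x c : Subset m → Subset n → ℕ) : Set where
    field
      no-left  : ∀ R → x ⊥ R ≡ 1
      no-right : ∀ {A} → Nonempty A → x A ⊥ ≡ 0
      left     : ∀ {A j} R → j ∈ A → x (A ∩ ∁ ⁅ j ⁆) R ≡ convolution c x A ⁅ j ⁆ R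
      right    : ∀ A {R r} → r ∉ R →
                 x A (R ∪ ⁅ r ⁆) ≡ x A R + convolution c x A (I (G *) r) R

  -- The left recurrence determines c A from smaller sets, since T = A contributes
  -- c A R · x ⊥ _ = c A R; the right recurrence then determines x A.
  recurrence-unique : ∀ {x c x′ c′} → Recurrence x c → Recurrence x′ c′ →
    ∀ k A → ∣ A ∣ ≤ k → (∀ R → x A R ≡ x′ A R) × (Nonempty A → ∀ R → c A R ≡ c′ A R)
  recurrence-unique {x} {c} {x′} {c′} rec rec′ k A ∣A∣≤k with nonempty? A
  ... | no none with Empty-unique none
  ... | refl = (λ R → trans (no-left rec R) (sym (no-left rec′ R))) ,
               λ ne → contradiction ne none
    where open Recurrence
  recurrence-unique {x} {c} {x′} {c′} rec rec′ zero A ∣A∣≤0 | yes (j , j∈A) =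
    contradiction (≤-trans (p⊂q⇒∣p∣<∣q∣ (∩∁-⊂ {p = A} {A} (j , x∈p∩q⁺ (j∈A , j∈A)))) ∣A∣≤0) λ ()
  recurrence-unique {x} {c} {x′} {c′} rec rec′ (suc k) A ∣A∣≤k | yes (j , j∈A) =
    (λ R → x-agree ∣ R ∣ R ≤-refl) , λ _ → c-agree
    where
    open Recurrence
    IH : ∀ B → B ⊂ A → (∀ R → x B R ≡ x′ B R) × (Nonempty B → ∀ R → c B R ≡ c′ B R)
    IH B B⊂A = recurrence-unique rec rec′ k B (≤-pred (≤-trans (p⊂q⇒∣p∣<∣q∣ B⊂A) ∣A∣≤k))

    -- `T` is a nonempty subset of `A`, so removing it leaves a proper subset and the induction
    -- hypothesis applies.
    rest-agree : ∀ {S T} → Below A S T → ∀ R → x (A ∩ ∁ T) R ≡ x′ (A ∩ ∁ T) R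
    rest-agree {S} {T} (T⊆A , i , i∈) = let i∈T = p∩q⊆p T S i∈ in
      proj₁ (IH _ (∩∁-⊂ {p = A} {T} (i , x∈p∩q⁺ (T⊆A i∈T , i∈T))))

    c-agree : ∀ R → c A R ≡ c′ A R
    c-agree R = trans (sym (last rec)) (trans
      (sum-cancel (λ T → c T R · x (A ∩ ∁ T) (R ∩ ∁ (N T)))
                  (λ T → c′ T R · x′ (A ∩ ∁ T) (R ∩ ∁ (N T)))
                  (elems (enum-below A ⁅ j ⁆))
                  (complete (enum-below A ⁅ j ⁆) (⊆-refl , j , x∈p∩q⁺ (j∈A , x∈⁅x⁆ j)))
                  smaller
                  (trans (sym (left rec R j∈A)) (trans
                    (proj₁ (IH _ (∩∁-⊂ {p = A} {⁅ j ⁆} (j , x∈p∩q⁺ (j∈A , x∈⁅x⁆ j)))) R)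
                    (left rec′ R j∈A))))
      (last rec′))
      where
      last : ∀ {y d} → Recurrence y d → d A R · y (A ∩ ∁ A) (R ∩ ∁ (N A)) ≡ d A R
      last {y} {d} r = trans (cong (d A R ·_)
        (trans (cong (λ B → y B (R ∩ ∁ (N A))) (∩-inverseʳ A)) (no-left r _))) (*-identityʳ _)
      smaller : ∀ T → T List.∈ elems (enum-below A ⁅ j ⁆) → T ≡ A ⊎
                c T R · x (A ∩ ∁ T) (R ∩ ∁ (N T)) ≡ c′ T R · x′ (A ∩ ∁ T) (R ∩ ∁ (N T))
      smaller T T∈ with T ≟ₛ A | sound (enum-below A ⁅ j ⁆) T∈
      ... | yes T≡A | _ = inj₁ T≡A
      ... | no T≢A | below@(T⊆A , i , i∈) = inj₂ (cong₂ _·_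
        (proj₂ (IH T (⊆∧≢⇒⊂ T⊆A T≢A)) (i , p∩q⊆p T _ i∈) R) (rest-agree below _))

    convolution-agree : ∀ S R → convolution c x A S R ≡ convolution c′ x′ A S R
    convolution-agree S R = sum-cong _ _ (elems (enum-below A S)) (λ {T} T∈ → term T T∈)
      where
      term : ∀ T → T List.∈ elems (enum-below A S) →
             c T R · x (A ∩ ∁ T) (R ∩ ∁ (N T)) ≡ c′ T R · x′ (A ∩ ∁ T) (R ∩ ∁ (N T))
      term T T∈ with sound (enum-below A S) T∈ | T ≟ₛ A
      ... | below | yes refl = cong₂ _·_ (c-agree R) (rest-agree below _)
      ... | below@(T⊆A , i , i∈) | no T≢A = cong₂ _·_
        (proj₂ (IH T (⊆∧≢⇒⊂ T⊆A T≢A)) (i , p∩q⊆p T S i∈) R) (rest-agree below _)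

    -- Inner induction with `A` fixed: `l` bounds `∣ R ∣`, and one right vertex is removed at a
    -- time.
    x-agree : ∀ l R → ∣ R ∣ ≤ l → x A R ≡ x′ A R
    x-agree l R ∣R∣≤l with nonempty? R
    ... | no none with Empty-unique none
    ... | refl = trans (no-right rec (j , j∈A)) (sym (no-right rec′ (j , j∈A)))
    x-agree l R ∣R∣≤l | yes (r , r∈R) = go l ∣R∣≤l
      where
      R⁻ = R ∩ ∁ ⁅ r ⁆
      R⁻⊂R : R⁻ ⊂ R
      R⁻⊂R = ∩∁-⊂ (r , x∈p∩q⁺ (r∈R , x∈⁅x⁆ r))
      r∉ : r ∉ R⁻
      r∉ r∈ = ∩∁-disjoint r∈ (x∈⁅x⁆ r)
      R≡ : R⁻ ∪ ⁅ r ⁆ ≡ R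
      R≡ = trans (∪-comm R⁻ ⁅ r ⁆)
             (∪-cover (⁅⁆⊆ r∈R))
      go : ∀ l → ∣ R ∣ ≤ l → x A R ≡ x′ A R
      go zero ∣R∣≤0 = contradiction (≤-trans (p⊂q⇒∣p∣<∣q∣ R⁻⊂R) ∣R∣≤0) λ ()
      go (suc l) ∣R∣≤l = subst (λ Q → x A Q ≡ x′ A Q) R≡
        (trans (right rec A r∉) (trans
          (cong₂ _+_ (x-agree l R⁻ (≤-pred (≤-trans (p⊂q⇒∣p∣<∣q∣ R⁻⊂R) ∣R∣≤l)))
                     (convolution-agree _ _))
          (sym (right rec′ A r∉))))

  -- Positive sequences satisfy the recurrence

  -- Entries up to `suc n` are searched because vectors that are tight or satisfy `IndS` may exceed
  -- Hall's bound by one.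
  enum-vectors : {P : Vec ℕ m → Set} → Decidable P → (∀ {a} → P a → wt ⊤ a ≤ suc n) →
                 Enumeration P
  enum-vectors P? bound = enum-filter (box (suc n) m) (box-unique (suc n) m) P?
    (λ {a} p → ∈-box a (λ j → ≤-trans (lookup≤wt⊤ a j) (bound p)))

  hi≤n : ∀ Q J → hi Q J ≤ n
  hi≤n Q J = ∣p∣≤n (N J ∩ Q)

  -- These give the first pair of counts in the recursion: `IsP` yields `X A R`, and `IsCP` yields
  -- the coefficient `c T R`.
  IsP IsCP : Subset m → Subset n → Vec ℕ m → Set
  IsP  A R a = supp a ≡ A × Ind a R
  IsCP T R a = supp a ≡ T × Tight T a R

  IsPS : Subset m → Subset m → Subset n → Vec ℕ m → Set
  IsPS S A R a = supp a ≡ A × IndS S a R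

  enumP : ∀ A R → Enumeration (IsP A R)
  enumP A R = enum-vectors (λ a → (supp a ≟ₛ A) ×-dec ind? a R)
    (λ {a} (_ , ind) → ≤-trans (ind ⊤) (m≤n⇒m≤1+n (hi≤n R ⊤)))

  enumCP : ∀ T R → Enumeration (IsCP T R)
  enumCP T R = enum-vectors (λ a → (supp a ≟ₛ T) ×-dec tight? T a R) bound
    where
    bound : ∀ {a} → IsCP T R a → wt ⊤ a ≤ suc n
    bound {a} (refl , eq , _) =
      ≤-trans (≤-reflexive (trans (wt⊤≡wt-supp a) eq)) (s≤s (hi≤n R T))

  enumPS : ∀ S A R → Enumeration (IsPS S A R)
  enumPS S A R = enum-vectors (λ a → (supp a ≟ₛ A) ×-dec indS? S a R)
    (λ {a} (_ , ind) → [ (λ le → ≤-trans le (m≤n⇒m≤1+n (hi≤n R ⊤)))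
                       , (λ (_ , le) → ≤-trans le (s≤s (hi≤n R ⊤))) ] (ind ⊤))

  #P #CP : Subset m → Subset n → ℕ
  #P  A R = size (enumP A R)
  #CP T R = size (enumCP T R)

  IsPair : Subset m → Subset n → Subset m → Vec ℕ m × Vec ℕ m → Set
  IsPair A R T = Both (IsCP T R) (IsP (A ∩ ∁ T) (R ∩ ∁ (N T)))

  -- The summands have supports `T` and `A ∩ ∁ T`, so masking recovers each of them, and tightness
  -- and independence carry over to the sum.
  pair-glue : ∀ {A R T a b} → T ⊆ A → IsPair A R T (a , b) →
              supp (a ⊞ b) ≡ A × Critical T (a ⊞ b) R ×
              mask T (a ⊞ b) ≡ a × mask (∁ T) (a ⊞ b) ≡ b
  pair-glue {A} {R} {T} {a} {b} T⊆A ((refl , tight) , (sb , ind)) =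
    trans (supp-⊞ a b) (trans (cong (supp a ∪_) sb) (∪-cover T⊆A)) ,
    (tight-unmask (subst (λ v → Tight T v R) (sym left≡) tight) ,
     subst (λ v → Ind v _) (sym right≡) ind) ,
    left≡ , right≡
    where
    left≡ : mask T (a ⊞ b) ≡ a
    left≡ = mask-left A a b sb
    right≡ : mask (∁ T) (a ⊞ b) ≡ b
    right≡ = mask-right A a b sb

  critical-pair : ∀ {A R T a} → supp a ≡ A → Critical T a R →
                  T ⊆ A × IsPair A R T (mask T a , mask (∁ T) a)
  critical-pair {T = T} {a} refl (tight , ind) =
    T⊆ , ((trans (supp-mask T a) (trans (∩-comm (supp a) T) (⊆⇒∩≡ T⊆)) , tight-mask tight) ,
          (supp-mask (∁ T) a , ind))
    where
    T⊆ : T ⊆ supp a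
    T⊆ = tight⊆supp tight

  size-convolution : ∀ {X : Set} {C M : Subset m → Subset n → X → Set}
    (eC : ∀ T R → Enumeration (C T R)) (eM : ∀ T R → Enumeration (M T R)) A S R →
    size (enum-Σ (enum-below A S) (λ T → enum-× (eC T R) (eM (A ∩ ∁ T) (R ∩ ∁ (N T)))))
    ≡ convolution (λ T R → size (eC T R)) (λ A R → size (eM A R)) A S R
  size-convolution eC eM A S R = trans
    (size-Σ (enum-below A S) (λ T → enum-× (eC T R) (eM (A ∩ ∁ T) (R ∩ ∁ (N T)))))
    (sum-cong _ _ (elems (enum-below A S))
      (λ {T} _ → size-× (eC T R) (eM (A ∩ ∁ T) (R ∩ ∁ (N T)))))

  -- By `indS-cases` an object is either independent or cut along a critical set meeting `S`.
  -- `critical-¬ind` keeps the two kinds apart, and `critical-unique` makes the cut unique.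
  #PS : ∀ S A R → size (enumPS S A R) ≡ #P A R + convolution #CP #P A S R
  #PS S A R = trans (sym (size-bijection (enumPS S A R) (enum-⊎ (enumP A R) pairs) g
      (λ {y} → to y) (λ {y} {y′} → inj y y′) surj))
    (trans (size-⊎ (enumP A R) pairs)
           (cong (#P A R +_) (size-convolution enumCP enumP A S R)))
    where
    Pairs : Subset m × (Vec ℕ m × Vec ℕ m) → Set
    Pairs = Dependent (Below A S) (IsPair A R)
    pairs : Enumeration Pairs
    pairs = enum-Σ (enum-below A S) (λ T → enum-× (enumCP T R) (enumP (A ∩ ∁ T) (R ∩ ∁ (N T))))
    g : Vec ℕ m ⊎ (Subset m × (Vec ℕ m × Vec ℕ m)) → Vec ℕ m
    g = [ id , (λ (_ , a , b) → a ⊞ b) ]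
    to : ∀ y → Either (IsP A R) Pairs y → IsPS S A R (g y)
    to (inj₁ a) (eq , ind) = eq , inj₁ ∘ ind
    to (inj₂ (T , a , b)) ((T⊆A , meets) , q) =
      let eq , crit , _ = pair-glue T⊆A q in eq , critical-indS meets crit
    inj : ∀ y y′ → Either (IsP A R) Pairs y → Either (IsP A R) Pairs y′ → g y ≡ g y′ → y ≡ y′
    inj (inj₁ a) (inj₁ a′) _ _ refl = refl
    inj (inj₁ a) (inj₂ (T , b , c)) (_ , ind) ((T⊆A , _) , q) refl =
      contradiction ind (critical-¬ind (proj₁ (proj₂ (pair-glue T⊆A q))))
    inj (inj₂ (T , b , c)) (inj₁ a) ((T⊆A , _) , q) (_ , ind) refl =
      contradiction ind (critical-¬ind (proj₁ (proj₂ (pair-glue T⊆A q))))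
    inj (inj₂ (T , a , b)) (inj₂ (T′ , a′ , b′)) ((T⊆A , _) , q) ((T′⊆A , _) , q′) eq
      with pair-glue T⊆A q | pair-glue T′⊆A q′
    ... | _ , crit , l , r | _ , crit′ , l′ , r′
      with critical-unique crit (subst (λ v → Critical T′ v R) (sym eq) crit′)
    ... | refl = cong₂ (λ u v → inj₂ (T , u , v))
      (trans (sym l) (trans (cong (mask T) eq) l′))
      (trans (sym r) (trans (cong (mask (∁ T)) eq) r′))
    surj : ∀ {a} → IsPS S A R a → ∃ λ y → Either (IsP A R) Pairs y × g y ≡ a
    surj {a} (eq , indS) with indS-cases indS
    ... | inj₁ ind = inj₁ a , (eq , ind) , refl
    ... | inj₂ (T , meets , crit) =
      let T⊆A , q = critical-pair eq crit in
      inj₂ (T , mask T a , mask (∁ T) a) , ((T⊆A , meets) , q) , mask-⊞ T a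

  -- An extra vertex seen only by `j` allows exactly one more unit at `j`. Removing that unit gives
  -- an independent vector, whose support is `A` or `A` without `j` according to whether the
  -- coordinate at `j` stays positive.
  #P-left : ∀ {A j} R → j ∈ A →
            size (enumPS ⁅ j ⁆ A R) ≡ #P A R + #P (A ∩ ∁ ⁅ j ⁆) R
  #P-left {A} {j} R j∈A = trans (sym (size-bijection (enumPS ⁅ j ⁆ A R)
      (enum-⊎ (enumP A R) (enumP A⁻ R)) g (λ {y} → to y) (λ {y} {y′} → inj y y′) surj))
    (size-⊎ (enumP A R) (enumP A⁻ R))
    where
    A⁻ = A ∩ ∁ ⁅ j ⁆
    inc : Vec ℕ m → Vec ℕ m
    inc a = a ⊞ indicator ⁅ j ⁆
    g : Vec ℕ m ⊎ Vec ℕ m → Vec ℕ m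
    g = [ inc , inc ]
    wt-inc : ∀ J a → wt J (inc a) ≡ wt J a + ∣ J ∩ ⁅ j ⁆ ∣
    wt-inc J a = trans (wt-⊞ J a _) (cong (wt J a +_) (wt-indicator J ⁅ j ⁆))
    ∣∩j∣≤1 : ∀ J → ∣ J ∩ ⁅ j ⁆ ∣ ≤ 1
    ∣∩j∣≤1 J = ≤-trans (∣p∩q∣≤∣q∣ J ⁅ j ⁆) (≤-reflexive (∣⁅x⁆∣≡1 j))
    ⁅j⁆⊆A : ⁅ j ⁆ ⊆ A
    ⁅j⁆⊆A = ⁅⁆⊆ j∈A
    inc-indS : ∀ {a} → Ind a R → IndS ⁅ j ⁆ (inc a) R
    inc-indS {a} ind J with nonempty? (J ∩ ⁅ j ⁆)
    ... | yes meets = inj₂ (meets , ≤-trans (≤-reflexive (wt-inc J a))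
      (≤-trans (+-mono-≤ (ind J) (∣∩j∣≤1 J)) (≤-reflexive (+-comm _ 1))))
    ... | no none = inj₁ (≤-trans (≤-reflexive (trans (wt-inc J a)
      (trans (cong (wt J a +_) (trans (cong ∣_∣ (Empty-unique none)) (∣⊥∣≡0 m))) (+-identityʳ _))))
      (ind J))
    supp-inc : ∀ a → supp (inc a) ≡ supp a ∪ ⁅ j ⁆
    supp-inc a = trans (supp-⊞ a _) (cong (supp a ∪_) (supp-indicator ⁅ j ⁆))
    to : ∀ y → Either (IsP A R) (IsP A⁻ R) y → IsPS ⁅ j ⁆ A R (g y)
    to (inj₁ a) (refl , ind) = trans (supp-inc a) (⊆-antisym
      (λ x∈ → [ id , ⁅j⁆⊆A ] (x∈p∪q⁻ _ _ x∈)) (p⊆p∪q ⁅ j ⁆)) , inc-indS ind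
    to (inj₂ a) (eq , ind) = trans (supp-inc a) (trans (cong (_∪ ⁅ j ⁆) eq)
      (trans (∪-comm A⁻ ⁅ j ⁆) (∪-cover ⁅j⁆⊆A))) , inc-indS ind
    A≢A⁻ : A ≢ A⁻
    A≢A⁻ eq = ∩∁-disjoint (subst (j ∈_) eq j∈A) (x∈⁅x⁆ j)
    inj : ∀ y y′ → Either (IsP A R) (IsP A⁻ R) y → Either (IsP A R) (IsP A⁻ R) y′ →
          g y ≡ g y′ → y ≡ y′
    inj (inj₁ a) (inj₁ b) _ _ eq = cong inj₁ (⊞-cancelʳ a b _ eq)
    inj (inj₂ a) (inj₂ b) _ _ eq = cong inj₂ (⊞-cancelʳ a b _ eq)
    inj (inj₁ a) (inj₂ b) (p , _) (q , _) eq =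
      contradiction (trans (sym p) (trans (cong supp (⊞-cancelʳ a b _ eq)) q)) A≢A⁻
    inj (inj₂ a) (inj₁ b) (p , _) (q , _) eq =
      contradiction (trans (sym q) (trans (cong supp (sym (⊞-cancelʳ a b _ eq))) p)) A≢A⁻
    surj : ∀ {a} → IsPS ⁅ j ⁆ A R a → ∃ λ y → Either (IsP A R) (IsP A⁻ R) y × g y ≡ a
    surj {a} (refl , indS) with decrement a j j∈A
    ... | b , refl = cases
      where
      ind : Ind b R
      ind J with indS J
      ... | inj₁ le = ≤-trans (m≤m+n (wt J b) _) (≤-trans (≤-reflexive (sym (wt-inc J b))) le)
      -- Here `J` contains `j`, so the unit removed at `j` compensates for the allowed excess.
      ... | inj₂ ((_ , i∈) , le) = ≤-pred (≤-trans (≤-reflexive (+-comm 1 _))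
        (≤-trans (+-monoʳ-≤ (wt J b) (∈⇒0<∣∣ i∈)) (≤-trans (≤-reflexive (sym (wt-inc J b))) le)))
      cases : ∃ λ y → Either (IsP (supp (inc b)) R) (IsP A⁻ R) y × g y ≡ inc b
      cases with j ∈? supp b
      ... | yes j∈b = inj₁ b , (sym (trans (supp-inc b) (⊆-antisym
        (λ x∈ → [ id , ⁅⁆⊆ j∈b ] (x∈p∪q⁻ (supp b) ⁅ j ⁆ x∈))
        (p⊆p∪q ⁅ j ⁆))) , ind) , refl
      ... | no j∉b = inj₂ b , (sym (trans (cong (_∩ ∁ ⁅ j ⁆) (supp-inc b))
        (⊆-antisym fwd bwd)) , ind) , refl
        where
        fwd : (supp b ∪ ⁅ j ⁆) ∩ ∁ ⁅ j ⁆ ⊆ supp b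
        fwd x∈ with x∈p∩q⁻ (supp b ∪ ⁅ j ⁆) (∁ ⁅ j ⁆) x∈
        ... | x∈∪ , x∉j with x∈p∪q⁻ (supp b) ⁅ j ⁆ x∈∪
        ... | inj₁ x∈b = x∈b
        ... | inj₂ x∈j = contradiction x∈j (x∈∁p⇒x∉p x∉j)
        bwd : supp b ⊆ (supp b ∪ ⁅ j ⁆) ∩ ∁ ⁅ j ⁆
        bwd x∈b = x∈p∩q⁺ (p⊆p∪q ⁅ j ⁆ x∈b ,
          x∉p⇒x∈∁p (λ x∈j → j∉b (subst (_∈ supp b) (x∈⁅y⁆⇒x≡y j x∈j) x∈b)))

  ind⊥ : ∀ R → Ind (indicator ⊥) R
  ind⊥ R J = ≤-trans (≤-reflexive (trans (wt-indicator J ⊥)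
    (trans (cong ∣_∣ (∩-zeroʳ J)) (∣⊥∣≡0 m)))) z≤n

  hi⊥ : ∀ J → hi ⊥ J ≡ 0
  hi⊥ J = trans (cong ∣_∣ (∩-zeroʳ (N J))) (∣⊥∣≡0 n)

  P-recurrence : Recurrence #P #CP
  P-recurrence = record
    { no-left  = λ R → size-singleton (enumP ⊥ R) (indicator ⊥) (supp-indicator ⊥ , ind⊥ R)
                         (λ {a} (eq , _) → supp≡⊥ a eq)
    ; no-right = λ (j , j∈) → size-empty (enumP _ ⊥) λ { {a} (refl , ind) →
        <⇒≱ (supp-positive a j∈)
            (≤-trans (lookup≤wt⊤ a j) (≤-trans (ind ⊤) (≤-reflexive (hi⊥ ⊤)))) }
    -- `#P-left` and `#PS` count the same vectors; the common summand `#P A R` cancels.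
    ; left     = λ {A} {j} R j∈A → +-cancelˡ-≡ (#P A R) _ _
        (trans (sym (#P-left R j∈A)) (#PS ⁅ j ⁆ A R))
    ; right    = λ A {R} {r} r∉R → trans
        (size-cong (enumP A (R ∪ ⁅ r ⁆)) (enumPS (I (G *) r) A R)
          (λ (eq , ind) → eq , proj₁ (ind-cong-indS r∉R) ind)
          (λ (eq , indS) → eq , proj₂ (ind-cong-indS r∉R) indS))
        (#PS (I (G *) r) A R)
    }

  -- Matched sets satisfy the recurrence

  -- The second pair of counts: `IsM` yields `X A R` and `IsCM` yields `c T R`. Confining `B` to
  -- `N T` in `IsCM` keeps it disjoint from the complementary part, which lives in `∁ (N T)`.
  IsM IsCM : Subset m → Subset n → Subset n → Set
  IsM  A R B = B ⊆ R × ∣ B ∣ ≡ ∣ A ∣ × Ind (indicator A) B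
  IsCM T R B = B ⊆ R ∩ N T × suc ∣ B ∣ ≡ ∣ T ∣ × Tight T (indicator T) B

  -- `B` is one vertex short of matching `A`; the added vertex with neighbourhood `S` supplies the
  -- missing partner.
  IsMS : Subset m → Subset m → Subset n → Subset n → Set
  IsMS S A R B = B ⊆ R × suc ∣ B ∣ ≡ ∣ A ∣ × IndS S (indicator A) B

  enumM : ∀ A R → Enumeration (IsM A R)
  enumM A R = enum-subsets (λ B → (B ⊆? R) ×-dec (∣ B ∣ ≟ ∣ A ∣) ×-dec ind? (indicator A) B)

  enumCM : ∀ T R → Enumeration (IsCM T R)
  enumCM T R = enum-subsets (λ B → (B ⊆? (R ∩ N T)) ×-dec (suc ∣ B ∣ ≟ ∣ T ∣) ×-dec
                                   tight? T (indicator T) B)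

  enumMS : ∀ S A R → Enumeration (IsMS S A R)
  enumMS S A R = enum-subsets (λ B → (B ⊆? R) ×-dec (suc ∣ B ∣ ≟ ∣ A ∣) ×-dec
                                     indS? S (indicator A) B)

  #M #CM : Subset m → Subset n → ℕ
  #M  A R = size (enumM A R)
  #CM T R = size (enumCM T R)

  hi-∩N : ∀ {B T U} → U ⊆ T → hi (B ∩ N T) U ≡ hi B U
  hi-∩N {B} {T} {U} U⊆T = cong ∣_∣ (⊆-antisym
    (∩-mono {p = N U} {q = B ∩ N T} id (p∩q⊆p B (N T)))
    (λ x∈ → let a , b = x∈p∩q⁻ (N U) B x∈ in x∈p∩q⁺ (a , x∈p∩q⁺ (b , N-mono U⊆T a))))

  wt-indicator-⊆ : ∀ {A T U : Subset m} → U ⊆ T → T ⊆ A →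
                   wt U (indicator T) ≡ wt U (indicator A)
  wt-indicator-⊆ {A} {T} {U} U⊆T T⊆A = trans (wt-indicator U T) (trans
    (cong ∣_∣ (trans (⊆⇒∩≡ U⊆T) (sym (⊆⇒∩≡ (⊆-trans U⊆T T⊆A))))) (sym (wt-indicator U A)))

  IsSplit : Subset m → Subset n → Subset m → Subset n × Subset n → Set
  IsSplit A R T = Both (IsCM T R) (IsM (A ∩ ∁ T) (R ∩ ∁ (N T)))

  ∣A∣-split : ∀ {A T : Subset m} → T ⊆ A → ∣ A ∣ ≡ ∣ T ∣ + ∣ A ∩ ∁ T ∣
  ∣A∣-split {A} {T} T⊆A = trans (∣∣-split A T)
    (cong (λ K → ∣ K ∣ + ∣ A ∩ ∁ T ∣) (trans (∩-comm A T) (⊆⇒∩≡ T⊆A)))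

  -- `B` lies in `N T` and `C` avoids it, so intersecting with `N T` and its complement recovers
  -- both. The single missing vertex of the union is the one missing from `B`.
  split-glue : ∀ {A R T B C} → T ⊆ A → IsSplit A R T (B , C) →
               B ∪ C ⊆ R × suc ∣ B ∪ C ∣ ≡ ∣ A ∣ × Critical T (indicator A) (B ∪ C) ×
               (B ∪ C) ∩ N T ≡ B × (B ∪ C) ∩ ∁ (N T) ≡ C
  split-glue {A} {R} {T} {B} {C} T⊆A ((B⊆ , ∣B∣ , tight) , (C⊆ , ∣C∣ , ind)) =
    (λ x∈ → [ p∩q⊆p R (N T) ∘ B⊆ , p∩q⊆p R (∁ (N T)) ∘ C⊆ ] (x∈p∪q⁻ B C x∈)) ,
    trans (cong suc (trans (∣∣-split (B ∪ C) (N T)) (cong₂ (λ p q → ∣ p ∣ + ∣ q ∣) B≡ C≡)))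
          (trans (cong₂ _+_ ∣B∣ ∣C∣) (sym (∣A∣-split T⊆A))) ,
    (tight-cong (λ U⊆T → wt-indicator-⊆ U⊆T T⊆A)
       (λ {U} U⊆T → trans (cong (λ Q → hi Q U) (sym B≡)) (hi-∩N U⊆T)) tight ,
     subst₂ Ind (sym (mask-indicator (∁ T) A)) (sym C≡) ind) ,
    B≡ , C≡
    where
    C∉N : ∀ {x} → x ∈ C → x ∉ N T
    C∉N x∈C = ∩∁-disjoint (C⊆ x∈C)
    B≡ : (B ∪ C) ∩ N T ≡ B
    B≡ = ⊆-antisym
      (λ x∈ → let x∈∪ , x∈N = x∈p∩q⁻ (B ∪ C) (N T) x∈ in
        [ id , (λ x∈C → contradiction x∈N (C∉N x∈C)) ] (x∈p∪q⁻ B C x∈∪))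
      (λ x∈B → x∈p∩q⁺ (p⊆p∪q C x∈B , p∩q⊆q R (N T) (B⊆ x∈B)))
    C≡ : (B ∪ C) ∩ ∁ (N T) ≡ C
    C≡ = ⊆-antisym
      (λ x∈ → let x∈∪ , x∉N = x∈p∩q⁻ (B ∪ C) (∁ (N T)) x∈ in
        [ (λ x∈B → contradiction (p∩q⊆q R (N T) (B⊆ x∈B)) (x∈∁p⇒x∉p x∉N)) , id ]
        (x∈p∪q⁻ B C x∈∪))
      (λ x∈C → x∈p∩q⁺ (q⊆p∪q B C x∈C , x∉p⇒x∈∁p (C∉N x∈C)))

  -- The tight equation fixes the size of `B ∩ N T` as one less than that of `T`; subtracting from
  -- the total size shows that the rest of `B` is exactly as large as the rest of `A`.
  critical-split : ∀ {A R T B} → B ⊆ R → suc ∣ B ∣ ≡ ∣ A ∣ → Critical T (indicator A) B →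
                   T ⊆ A × IsSplit A R T (B ∩ N T , B ∩ ∁ (N T))
  critical-split {A} {R} {T} {B} B⊆R ∣B∣ (tight@(eq , _) , ind) =
    T⊆A , ((∩-mono {p = B} {q = N T} B⊆R id , ∣B∩N∣ , tight′) ,
           (∩-mono {p = B} {q = ∁ (N T)} B⊆R id , ∣B∖N∣ ,
            subst (λ w → Ind w (B ∩ ∁ (N T))) (mask-indicator (∁ T) A) ind))
    where
    T⊆A : T ⊆ A
    T⊆A = subst (T ⊆_) (supp-indicator A) (tight⊆supp tight)
    tight′ : Tight T (indicator T) (B ∩ N T)
    tight′ = tight-cong (λ U⊆T → sym (wt-indicator-⊆ U⊆T T⊆A)) (λ U⊆T → sym (hi-∩N U⊆T)) tight
    ∣B∩N∣ : suc ∣ B ∩ N T ∣ ≡ ∣ T ∣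
    ∣B∩N∣ = trans (cong (suc ∘ ∣_∣) (∩-comm B (N T))) (trans (sym eq)
      (trans (wt-indicator T A) (cong ∣_∣ (⊆⇒∩≡ T⊆A))))
    ∣B∖N∣ : ∣ B ∩ ∁ (N T) ∣ ≡ ∣ A ∩ ∁ T ∣
    ∣B∖N∣ = +-cancelˡ-≡ ∣ T ∣ _ _ (trans (cong (_+ ∣ B ∩ ∁ (N T) ∣) (sym ∣B∩N∣))
      (trans (cong suc (sym (∣∣-split B (N T)))) (trans ∣B∣ (∣A∣-split T⊆A))))

  ind⇒∣∣≤ : ∀ {A B} → Ind (indicator A) B → ∣ A ∣ ≤ ∣ B ∣
  ind⇒∣∣≤ {A} {B} ind = begin
    ∣ A ∣              ≡⟨ cong ∣_∣ (∩-identityˡ A) ⟨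
    ∣ ⊤ ∩ A ∣          ≡⟨ wt-indicator ⊤ A ⟨
    wt ⊤ (indicator A) ≤⟨ ind ⊤ ⟩
    hi B ⊤             ≤⟨ ∣p∩q∣≤∣q∣ (N ⊤) B ⟩
    ∣ B ∣              ∎
    where open ≤-Reasoning

  -- Unlike in `#PS`, there is no independent summand: Hall's condition would force `∣ A ∣ ≤ ∣ B ∣`,
  -- while `B` has one element fewer than `A`.
  #MS : ∀ S A R → size (enumMS S A R) ≡ convolution #CM #M A S R
  #MS S A R = trans (sym (size-bijection (enumMS S A R) pairs (λ (_ , B , C) → B ∪ C)
      to inj surj))
    (size-convolution enumCM enumM A S R)
    where
    Pairs : Subset m × (Subset n × Subset n) → Set
    Pairs = Dependent (Below A S) (IsSplit A R)
    pairs : Enumeration Pairs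
    pairs = enum-Σ (enum-below A S) (λ T → enum-× (enumCM T R) (enumM (A ∩ ∁ T) (R ∩ ∁ (N T))))
    to : ∀ {y} → Pairs y → IsMS S A R (proj₁ (proj₂ y) ∪ proj₂ (proj₂ y))
    to ((T⊆A , meets) , q) =
      let ⊆R , size≡ , crit , _ = split-glue T⊆A q in ⊆R , size≡ , critical-indS meets crit
    inj : ∀ {y y′} → Pairs y → Pairs y′ →
          proj₁ (proj₂ y) ∪ proj₂ (proj₂ y) ≡ proj₁ (proj₂ y′) ∪ proj₂ (proj₂ y′) → y ≡ y′
    inj {T , B , C} {T′ , B′ , C′} ((T⊆A , _) , q) ((T′⊆A , _) , q′) eq
      with split-glue T⊆A q | split-glue T′⊆A q′
    ... | _ , _ , crit , l , r | _ , _ , crit′ , l′ , r′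
      with critical-unique crit (subst (Critical T′ (indicator A)) (sym eq) crit′)
    ... | refl = cong₂ (λ u v → T , u , v)
      (trans (sym l) (trans (cong (_∩ N T) eq) l′))
      (trans (sym r) (trans (cong (_∩ ∁ (N T)) eq) r′))
    surj : ∀ {B} → IsMS S A R B → ∃ λ y → Pairs y × proj₁ (proj₂ y) ∪ proj₂ (proj₂ y) ≡ B
    surj {B} (B⊆R , ∣B∣ , indS) with indS-cases indS
    ... | inj₁ ind = contradiction (ind⇒∣∣≤ ind) (<⇒≱ (≤-reflexive ∣B∣))
    ... | inj₂ (T , meets , crit) =
      let T⊆A , q = critical-split B⊆R ∣B∣ crit in
      (T , B ∩ N T , B ∩ ∁ (N T)) , ((T⊆A , meets) , q) , ∩-∪-∩∁ B (N T)

  -- The extra vertex can only be matched to `j`, so `B` has to serve precisely the other vertices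
  -- of `A`; the same sets `B` are counted on both sides.
  #M-left : ∀ {A j} R → j ∈ A → #M (A ∩ ∁ ⁅ j ⁆) R ≡ size (enumMS ⁅ j ⁆ A R)
  #M-left {A} {j} R j∈A = size-cong (enumM A⁻ R) (enumMS ⁅ j ⁆ A R)
    (λ (B⊆R , eq , ind) → B⊆R , trans (cong suc eq) (sym ∣A∣≡) , to ind)
    (λ (B⊆R , eq , indS) → B⊆R , suc-injective (trans eq ∣A∣≡) , from indS)
    where
    A⁻ = A ∩ ∁ ⁅ j ⁆
    ∣A∣≡ : ∣ A ∣ ≡ suc ∣ A⁻ ∣
    ∣A∣≡ = trans (∣A∣-split (⁅⁆⊆ j∈A)) (cong (_+ ∣ A⁻ ∣) (∣⁅x⁆∣≡1 j))
    module _ {B : Subset n} where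
      to : Ind (indicator A⁻) B → IndS ⁅ j ⁆ (indicator A) B
      to ind J with nonempty? (J ∩ ⁅ j ⁆)
      ... | yes meets = inj₂ (meets , (begin
        wt J (indicator A)           ≡⟨ wt-indicator J A ⟩
        ∣ J ∩ A ∣                    ≤⟨ ∣∣≤-split {p₁ = ⁅ j ⁆} ⁅ j ⁆ (p∩q⊆q _ _) (λ x∈ →
                                          let a , b = x∈p∩q⁻ (J ∩ A) (∁ ⁅ j ⁆) x∈
                                              c , d = x∈p∩q⁻ J A a in
                                          x∈p∩q⁺ (c , x∈p∩q⁺ (d , b))) ⟩
        ∣ ⁅ j ⁆ ∣ + ∣ J ∩ A⁻ ∣       ≡⟨ cong₂ _+_ (∣⁅x⁆∣≡1 j) (sym (wt-indicator J A⁻)) ⟩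
        suc (wt J (indicator A⁻))    ≤⟨ s≤s (ind J) ⟩
        suc (hi B J)                 ∎))
        where open ≤-Reasoning
      ... | no none = inj₁ (begin
        wt J (indicator A)           ≡⟨ wt-indicator J A ⟩
        ∣ J ∩ A ∣                    ≤⟨ p⊆q⇒∣p∣≤∣q∣ (λ {x} x∈ →
                                          let c , d = x∈p∩q⁻ J A x∈ in
                                          x∈p∩q⁺ (c , x∈p∩q⁺ (d ,
                                            x∉p⇒x∈∁p (λ x∈j → none (x , x∈p∩q⁺ (c , x∈j)))))) ⟩
        ∣ J ∩ A⁻ ∣                   ≡⟨ wt-indicator J A⁻ ⟨
        wt J (indicator A⁻)          ≤⟨ ind J ⟩
        hi B J                       ∎)
        where open ≤-Reasoning
      from : IndS ⁅ j ⁆ (indicator A) B → Ind (indicator A⁻) B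
      -- Testing on `J` without `j` rules out the alternative that allows an excess.
      from indS J with indS (J ∩ ∁ ⁅ j ⁆)
      ... | inj₂ ((x , x∈) , _) = let a , b = x∈p∩q⁻ (J ∩ ∁ ⁅ j ⁆) ⁅ j ⁆ x∈ in
        contradiction b (∩∁-disjoint a)
      ... | inj₁ le = begin
        wt J (indicator A⁻)                ≡⟨ wt-indicator J A⁻ ⟩
        ∣ J ∩ A⁻ ∣                         ≤⟨ p⊆q⇒∣p∣≤∣q∣ (λ x∈ →
                                                let a , b = x∈p∩q⁻ J A⁻ x∈
                                                    c , d = x∈p∩q⁻ A (∁ ⁅ j ⁆) b in
                                                x∈p∩q⁺ (x∈p∩q⁺ (a , d) , c)) ⟩
        ∣ (J ∩ ∁ ⁅ j ⁆) ∩ A ∣              ≡⟨ wt-indicator (J ∩ ∁ ⁅ j ⁆) A ⟨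
        wt (J ∩ ∁ ⁅ j ⁆) (indicator A)     ≤⟨ le ⟩
        hi B (J ∩ ∁ ⁅ j ⁆)                 ≤⟨ hi-mono {B} ⊆-refl (p∩q⊆p J (∁ ⁅ j ⁆)) ⟩
        hi B J                             ∎
        where open ≤-Reasoning

  -- Sort the matched sets by whether they contain `r`. Removing `r` leaves a set one vertex short,
  -- for which `r` plays the added vertex.
  #M-right : ∀ A {R r} → r ∉ R →
             #M A R + size (enumMS (I (G *) r) A R) ≡ #M A (R ∪ ⁅ r ⁆)
  #M-right A {R} {r} r∉R = trans (sym (size-⊎ (enumM A R) (enumMS S A R)))
    (size-bijection (enumM A (R ∪ ⁅ r ⁆)) (enum-⊎ (enumM A R) (enumMS S A R))
      g (λ {y} → to y) (λ {y} {y′} → inj y y′) surj)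
    where
    S = I (G *) r
    g : Subset n ⊎ Subset n → Subset n
    g = [ id , _∪ ⁅ r ⁆ ]
    remove : ∀ {B} → r ∉ B → (B ∪ ⁅ r ⁆) ∩ ∁ ⁅ r ⁆ ≡ B
    remove {B} r∉B = ⊆-antisym
      (λ x∈ → let a , b = x∈p∩q⁻ (B ∪ ⁅ r ⁆) (∁ ⁅ r ⁆) x∈ in
        [ id , (λ x∈r → contradiction x∈r (x∈∁p⇒x∉p b)) ] (x∈p∪q⁻ B ⁅ r ⁆ a))
      (λ x∈ → x∈p∩q⁺ (p⊆p∪q ⁅ r ⁆ x∈ , x∉p⇒x∈∁p (λ x∈r →
        r∉B (subst (_∈ B) (x∈⁅y⁆⇒x≡y r x∈r) x∈))))
    ∣insert∣ : ∀ {B} → r ∉ B → ∣ B ∪ ⁅ r ⁆ ∣ ≡ suc ∣ B ∣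
    ∣insert∣ {B} r∉B = trans (∣∣-split (B ∪ ⁅ r ⁆) ⁅ r ⁆) (cong₂ _+_
      (trans (cong ∣_∣ (trans (∩-comm (B ∪ ⁅ r ⁆) ⁅ r ⁆) (⊆⇒∩≡ (q⊆p∪q B ⁅ r ⁆)))) (∣⁅x⁆∣≡1 r))
      (cong ∣_∣ (remove r∉B)))
    r∈insert : ∀ B → r ∈ B ∪ ⁅ r ⁆
    r∈insert B = q⊆p∪q B ⁅ r ⁆ (x∈⁅x⁆ r)
    to : ∀ y → Either (IsM A R) (IsMS S A R) y → IsM A (R ∪ ⁅ r ⁆) (g y)
    to (inj₁ B) (B⊆R , eq , ind) = p⊆p∪q ⁅ r ⁆ ∘ B⊆R , eq , ind
    to (inj₂ B) (B⊆R , eq , indS) =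
      (λ x∈ → x∈p∪q⁺ (Sum.map₁ B⊆R (x∈p∪q⁻ B ⁅ r ⁆ x∈))) ,
      trans (∣insert∣ (r∉R ∘ B⊆R)) eq , proj₂ (ind-cong-indS (r∉R ∘ B⊆R)) indS
    inj : ∀ y y′ → Either (IsM A R) (IsMS S A R) y → Either (IsM A R) (IsMS S A R) y′ →
          g y ≡ g y′ → y ≡ y′
    inj (inj₁ B) (inj₁ C) _ _ refl = refl
    inj (inj₁ B) (inj₂ C) (B⊆R , _) _ refl = contradiction (B⊆R (r∈insert C)) r∉R
    inj (inj₂ B) (inj₁ C) _ (C⊆R , _) refl = contradiction (C⊆R (r∈insert B)) r∉R
    inj (inj₂ B) (inj₂ C) (B⊆R , _) (C⊆R , _) eq = cong inj₂
      (trans (sym (remove (r∉R ∘ B⊆R))) (trans (cong (_∩ ∁ ⁅ r ⁆) eq) (remove (r∉R ∘ C⊆R))))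
    surj : ∀ {B} → IsM A (R ∪ ⁅ r ⁆) B → ∃ λ y → Either (IsM A R) (IsMS S A R) y × g y ≡ B
    surj {B} (B⊆ , eq , ind) with r ∈? B
    ... | no r∉B = inj₁ B , (B⊆R , eq , ind) , refl
      where
      B⊆R : B ⊆ R
      B⊆R x∈ = [ id , (λ x∈r → contradiction (subst (_∈ B) (x∈⁅y⁆⇒x≡y r x∈r) x∈) r∉B) ]
               (x∈p∪q⁻ R ⁅ r ⁆ (B⊆ x∈))
    ... | yes r∈B = inj₂ B⁻ , (B⁻⊆R , suc-injective∣∣ , indS) , B≡
      where
      B⁻ = B ∩ ∁ ⁅ r ⁆
      B≡ : B⁻ ∪ ⁅ r ⁆ ≡ B
      B≡ = trans (∪-comm B⁻ ⁅ r ⁆) (∪-cover (⁅⁆⊆ r∈B))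
      r∉B⁻ : r ∉ B⁻
      r∉B⁻ r∈ = ∩∁-disjoint r∈ (x∈⁅x⁆ r)
      B⁻⊆R : B⁻ ⊆ R
      B⁻⊆R x∈ = [ id , (λ x∈r → contradiction x∈r (∩∁-disjoint x∈)) ]
                (x∈p∪q⁻ R ⁅ r ⁆ (B⊆ (p∩q⊆p B (∁ ⁅ r ⁆) x∈)))
      suc-injective∣∣ : suc ∣ B⁻ ∣ ≡ ∣ A ∣
      suc-injective∣∣ = trans (sym (∣insert∣ r∉B⁻)) (trans (cong ∣_∣ B≡) eq)
      indS : IndS S (indicator A) B⁻
      indS = proj₁ (ind-cong-indS r∉B⁻) (subst (Ind (indicator A)) (sym B≡) ind)

  M-recurrence : Recurrence #M #CM
  M-recurrence = record
    { no-left  = λ R → size-singleton (enumM ⊥ R) ⊥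
        (⊥⊆ , trans (∣⊥∣≡0 n) (sym (∣⊥∣≡0 m)) , ind⊥ ⊥)
        (λ (_ , eq , _) → Empty-unique (λ (x , x∈) →
          <⇒≢ (∈⇒0<∣∣ x∈) (sym (trans eq (∣⊥∣≡0 m)))))
    ; no-right = λ (j , j∈) → size-empty (enumM _ ⊥) λ (B⊆⊥ , eq , _) →
        <⇒≱ (∈⇒0<∣∣ j∈) (≤-trans (≤-reflexive (sym eq))
          (≤-trans (p⊆q⇒∣p∣≤∣q∣ B⊆⊥) (≤-reflexive (∣⊥∣≡0 n))))
    ; left     = λ {A} {j} R j∈A → trans (#M-left R j∈A) (#MS ⁅ j ⁆ A R)
    ; right    = λ A {R} {r} r∉R → trans (sym (#M-right A r∉R))
        (cong (#M A R +_) (#MS (I (G *) r) A R))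
    }

  #P≡#M : ∀ A R → #P A R ≡ #M A R
  #P≡#M A = proj₁ (recurrence-unique P-recurrence M-recurrence ∣ A ∣ A ≤-refl)

-- Coefficients of the support-enumerator

coeff-⊕ : ∀ p q k → coeff (p ⊕ q) k ≡ coeff p k + coeff q k
coeff-⊕ []      q       k       = refl
coeff-⊕ (c ∷ p) []      k       = sym (+-identityʳ _)
coeff-⊕ (c ∷ p) (d ∷ q) zero    = refl
coeff-⊕ (c ∷ p) (d ∷ q) (suc k) = coeff-⊕ p q k

coeff-z^-≡ : ∀ k → coeff (z^ k) k ≡ 1
coeff-z^-≡ zero    = refl
coeff-z^-≡ (suc k) = coeff-z^-≡ k

coeff-z^-≢ : ∀ i k → i ≢ k → coeff (z^ i) k ≡ 0
coeff-z^-≢ zero    zero    i≢k = contradiction refl i≢k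
coeff-z^-≢ zero    (suc k) i≢k = refl
coeff-z^-≢ (suc i) zero    i≢k = refl
coeff-z^-≢ (suc i) (suc k) i≢k = coeff-z^-≢ i k (i≢k ∘ cong suc)

-- Each monomial contributes one to the coefficient of its own exponent and zero to every other.
coeff-sum : {X : Set} (f : X → ℕ) (xs : List X) (k : ℕ) →
            coeff (foldr _⊕_ [] (map (λ x → z^ (f x)) xs)) k ≡ length (filter (λ x → f x ≟ k) xs)
coeff-sum f []       k = refl
coeff-sum f (x ∷ xs) k = trans (coeff-⊕ (z^ (f x)) _ k) (step (f x ≟ k))
  where
  step : Dec (f x ≡ k) → coeff (z^ (f x)) k + coeff (foldr _⊕_ [] (map (λ x → z^ (f x)) xs)) k
                         ≡ length (filter (λ x → f x ≟ k) (x ∷ xs))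
  step (yes fx≡k) = trans
    (cong₂ _+_ (trans (cong (λ i → coeff (z^ i) k) fx≡k) (coeff-z^-≡ k)) (coeff-sum f xs k))
    (cong length (sym (filter-accept (λ x → f x ≟ k) fx≡k)))
  step (no fx≢k) = trans
    (cong₂ _+_ (coeff-z^-≢ (f x) k fx≢k) (coeff-sum f xs k))
    (cong length (sym (filter-reject (λ x → f x ≟ k) fx≢k)))

s≡∣supp∣ : (a : Vec ℕ m) → s a ≡ ∣ supp a ∣
s≡∣supp∣ []          = refl
s≡∣supp∣ (zero ∷ a)  = s≡∣supp∣ a
s≡∣supp∣ (suc x ∷ a) = cong suc (s≡∣supp∣ a)

filter-∈?-suc : ∀ b (J : Subset m) xs →
                filter (_∈? (b ∷ J)) (map suc xs) ≡ map suc (filter (_∈? J) xs)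
filter-∈?-suc b J []       = refl
filter-∈?-suc b J (x ∷ xs) with x ∈? J
... | yes _ = cong (suc x ∷_) (filter-∈?-suc b J xs)
... | no _  = filter-∈?-suc b J xs

elements-∷ : ∀ b (J : Subset m) → filter (_∈? (b ∷ J)) (tabulate suc) ≡ map suc (elements J)
elements-∷ b J = trans (cong (filter (_∈? (b ∷ J))) (sym (map-tabulate id suc)))
                       (filter-∈?-suc b J (allFin _))

∑≡wt : (J : Subset m) (a : Vec ℕ m) → ∑[ J ] a ≡ wt J a
∑≡wt []      []      = refl
∑≡wt (b ∷ J) (x ∷ a) = head b
  where
  -- The head bit decides only about index `zero`, so the contribution of the successor indices is
  -- the same for both values of `b`.
  tail : ∀ b → sum (map (lookup (x ∷ a)) (filter (_∈? (b ∷ J)) (tabulate suc))) ≡ wt J a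
  tail b = trans (cong (sum ∘ map (lookup (x ∷ a))) (elements-∷ b J))
                 (trans (cong sum (sym (map-∘ (elements J)))) (∑≡wt J a))
  head : ∀ b → ∑[ b ∷ J ] (x ∷ a) ≡ wt (b ∷ J) (x ∷ a)
  head true  = cong (x +_) (tail true)
  head false = tail false

module _ {m n : ℕ} (G : BipartiteGraph m n) where

  -- `Ind` also ranges over the empty set, where the weight is zero.
  draconian⇒ind : ∀ {a} → Draconian G a → Ind G a ⊤
  draconian⇒ind {a} dr J with nonempty? J
  ... | yes ne = subst₂ _≤_ (∑≡wt J a) (cong ∣_∣ (sym (∩-identityʳ (N G J)))) (dr J ne)
  ... | no none with Empty-unique none
  ... | refl = ≤-trans (≤-reflexive (wt-⊥ a)) z≤n

  ind⇒draconian : ∀ {a} → Ind G a ⊤ → Draconian G a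
  ind⇒draconian {a} ind J _ =
    subst₂ _≤_ (sym (∑≡wt J a)) (cong ∣_∣ (∩-identityʳ (N G J))) (ind J)

  enumD : ∀ k → Enumeration (λ a → Draconian G a × s a ≡ k)
  enumD k = record
    { elems    = filter (λ a → s a ≟ k) (D G)
    ; unique   = Unique.filter⁺ (λ a → s a ≟ k) (D-unique G)
    ; sound    = λ a∈ → let a∈D , eq = ∈-filter⁻ (λ a → s a ≟ k) {xs = D G} a∈ in
                        Equivalence.to (∈D⇔Draconian G _) a∈D , eq
    ; complete = λ (dr , eq) →
        ∈-filter⁺ (λ a → s a ≟ k) (Equivalence.from (∈D⇔Draconian G _) dr) eq
    }

  enum-size : ∀ k → Enumeration (λ (A : Subset m) → ∣ A ∣ ≡ k)
  enum-size k = enum-subsets (λ A → ∣ A ∣ ≟ k)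

  Matched : ℕ → Subset m × Subset n → Set
  Matched k = Dependent (λ A → ∣ A ∣ ≡ k) (λ A → IsM G A ⊤)

  enum-matched : ∀ k → Enumeration (Matched k)
  enum-matched k = enum-Σ (enum-size k) (λ A → enumM G A ⊤)

  -- Group the draconian sequences with `k` positive entries by their support `A`, then replace the
  -- count for each `A` by the number of sets matched to `A`.
  coeff-F : ∀ k → coeff (F G) k ≡ size (enum-matched k)
  coeff-F k = begin
    coeff (F G) k                                       ≡⟨ coeff-sum s (D G) k ⟩
    size (enumD k)                                      ≡⟨ size-bijection (enumD k) by-support proj₂
                                                             to inj surj ⟨
    size by-support                                     ≡⟨ size-Σ (enum-size k) (λ A → enumP G A ⊤) ⟩
    sum (map (λ A → #P G A ⊤) (elems (enum-size k)))    ≡⟨ sum-cong _ _ (elems (enum-size k))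
                                                             (λ {A} _ → #P≡#M G A ⊤) ⟩
    sum (map (λ A → #M G A ⊤) (elems (enum-size k)))    ≡⟨ size-Σ (enum-size k) (λ A → enumM G A ⊤) ⟨
    size (enum-matched k)                               ∎
    where
    open ≡-Reasoning
    Supported : Subset m × Vec ℕ m → Set
    Supported = Dependent (λ A → ∣ A ∣ ≡ k) (λ A → IsP G A ⊤)
    by-support : Enumeration Supported
    by-support = enum-Σ (enum-size k) (λ A → enumP G A ⊤)
    to : ∀ {y} → Supported y → Draconian G (proj₂ y) × s (proj₂ y) ≡ k
    to {_ , a} (eq , sa , ind) = ind⇒draconian ind , trans (s≡∣supp∣ a) (trans (cong ∣_∣ sa) eq)
    inj : ∀ {y y′} → Supported y → Supported y′ → proj₂ y ≡ proj₂ y′ → y ≡ y′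
    inj (_ , refl , _) (_ , refl , _) refl = refl
    surj : ∀ {a} → Draconian G a × s a ≡ k → ∃ λ y → Supported y × proj₂ y ≡ a
    surj {a} (dr , eq) =
      (supp a , a) , (trans (sym (s≡∣supp∣ a)) eq , refl , draconian⇒ind dr) , refl

-- For |A| = |B|, Hall's condition for K ⊆ B is Hall's condition for the vertices of A
-- with no neighbour in K.
ind-dual : (G : BipartiteGraph m n) {A : Subset m} {B : Subset n} →
           ∣ B ∣ ≡ ∣ A ∣ → Ind G (indicator A) B → Ind (G *) (indicator B) A
ind-dual G {A} {B} ∣B∣≡∣A∣ ind K = +-cancelʳ-≤ ∣ J ∣ _ _ (begin
  wt K (indicator B) + ∣ J ∣            ≡⟨ cong (_+ ∣ J ∣) (wt-indicator K B) ⟩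
  ∣ K ∩ B ∣ + ∣ J ∣                     ≡⟨ cong (λ p → ∣ p ∣ + ∣ J ∣) (∩-comm K B) ⟩
  ∣ B ∩ K ∣ + ∣ J ∣                     ≤⟨ +-monoʳ-≤ ∣ B ∩ K ∣ ∣J∣≤ ⟩
  ∣ B ∩ K ∣ + ∣ B ∩ ∁ K ∣               ≡⟨ ∣∣-split B K ⟨
  ∣ B ∣                                 ≡⟨ ∣B∣≡∣A∣ ⟩
  ∣ A ∣                                 ≡⟨ ∣∣-split A (N (G *) K) ⟩
  ∣ A ∩ N (G *) K ∣ + ∣ J ∣             ≡⟨ cong (λ p → ∣ p ∣ + ∣ J ∣) (∩-comm A (N (G *) K)) ⟩
  hi (G *) A K + ∣ J ∣                  ∎)
  where
  open ≤-Reasoning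
  J = A ∩ ∁ (N (G *) K)
  ∣J∣≤ : ∣ J ∣ ≤ ∣ B ∩ ∁ K ∣
  ∣J∣≤ = begin
    ∣ J ∣                  ≡⟨ cong ∣_∣ (⊆⇒∩≡ (p∩q⊆p A (∁ (N (G *) K)))) ⟨
    ∣ J ∩ A ∣              ≡⟨ wt-indicator J A ⟨
    wt J (indicator A)     ≤⟨ ind J ⟩
    hi G B J               ≤⟨ p⊆q⇒∣p∣≤∣q∣ avoids ⟩
    ∣ B ∩ ∁ K ∣            ∎
    where
    -- A neighbour of `J` lying in `K` would put a vertex of `J` into `N (G *) K`, which `J` avoids
    -- by construction.
    avoids : N G J ∩ B ⊆ B ∩ ∁ K
    avoids x∈ with x∈p∩q⁻ (N G J) B x∈
    ... | x∈N , x∈B with ∈N⁻ G J x∈N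
    ... | j , j∈J , adj =
      x∈p∩q⁺ (x∈B , x∉p⇒x∈∁p (λ x∈K → ∩∁-disjoint j∈J (∈N⁺ (G *) x∈K (∈I*⁺ G adj))))

matched-dual : (G : BipartiteGraph m n) {k : ℕ} {A : Subset m} {B : Subset n} →
               Matched G k (A , B) → Matched (G *) k (B , A)
matched-dual G (∣A∣ , _ , ∣B∣ , ind) =
  trans ∣B∣ ∣A∣ , ⊆⊤ , sym ∣B∣ , ind-dual G ∣B∣ ind

theorem1p3 : (m n : ℕ) (G : BipartiteGraph m n) → F G ≈ F (G *)
theorem1p3 m n G k = begin
  coeff (F G) k                ≡⟨ coeff-F G k ⟩
  size (enum-matched G k)      ≡⟨ size-bijection (enum-matched (G *) k) (enum-matched G k) swap
                                    (matched-dual G) (λ _ _ → cong swap)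
                                    -- `(G *) *` is `G` by definition, so dualising a second time
                                    -- gives the preimage under `swap`.
                                    (λ q → _ , matched-dual (G *) q , refl) ⟩
  size (enum-matched (G *) k)  ≡⟨ coeff-F (G *) k ⟨
  coeff (F (G *)) k            ∎
  where open ≡-Reasoning
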